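{- Let $p$ be an odd prime with $p\equiv 1\pmod 3$ and let $a$ be a positive integer. Then $$\sum_{k=0}^{\lfloor \frac{5}{6}p^a\rfloor}\frac{\binom{2k}{k}}{16^k}\equiv\left(\frac{3}{p^a}\right)\pmod{p^2},$$ where $\left(\frac{\cdot}{\cdot}\right)$ denotes the Jacobi symbol.
   Context: The congruence is understood for rational numbers whose denominators are coprime to $p$ (here the denominators are powers of $2$), i.e. $x\equiv y\pmod{p^2}$ means $x-y$ is $p^2$ times a rational number with denominator prime to $p$. -}

module Defs where

open import Data.Nat as ℕ using (ℕ; zero; suc; _≤ᵇ_)
open import Data.Nat.Divisibility using (_∣_)
open import Data.Nat.Coprimality using (Coprime)
open import Data.Nat.DivMod using (_%_; _/_)
open import Data.Nat.Combinatorics using (_C_)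
open import Data.Nat.Properties using (m^n≢0)
open import Data.Integer as ℤ using (ℤ; +_; -[1+_])
open import Data.Rational as ℚ using (ℚ; ↥_; ↧ₙ_)
open import Data.Bool using (Bool; true; false; if_then_else_)
open import Data.Product using (∃; _×_)
open import Relation.Binary.PropositionalEquality using (_≡_)

_≡_[modℚ_at_] : ℚ → ℚ → ℕ → ℕ → Set
x ≡ y [modℚ m at p ] =
  ∃ λ (z : ℚ) → Coprime (↧ₙ z) p × (x ℚ.- y ≡ (+ m ℚ./ 1) ℚ.* z)

sumℚ : ℕ → (ℕ → ℚ) → ℚ
sumℚ zero    f = f 0
sumℚ (suc n) f = sumℚ n f ℚ.+ f (suc n)

term : ℕ → ℚ
term k = (+ ((2 ℕ.* k) C k)) ℚ./ (16 ℕ.^ k)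
  where instance _ = m^n≢0 16 k

isSquareModᵇ : ℕ → ℕ → Bool
isSquareModᵇ a zero = false
isSquareModᵇ a (suc q) = go (suc q)
  where
  p = suc q
  go : ℕ → Bool
  go zero = false
  go (suc x) = if ((x ℕ.* x) % p) ℕ.≡ᵇ (a % p) then true else go x

legendre : ℕ → ℕ → ℤ
legendre a zero = + 0
legendre a (suc q) =
  if (a % suc q) ℕ.≡ᵇ 0 then + 0
  else if isSquareModᵇ a (suc q) then + 1 else -[1+ 0 ]

smallestDivisor : ℕ → ℕ
smallestDivisor n = go n 2
  where
  go : ℕ → ℕ → ℕ
  go zero d = n
  go (suc fuel) d =
    if (n % suc (d ℕ.∸ 1)) ℕ.≡ᵇ 0 then d else go fuel (suc d)

-- Jacobi symbol (a/n) for odd positive n: the product of the Legendre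
-- symbols (a/q) over the prime factors q of n counted with multiplicity;
-- (a/1) = 1.  Computed by repeatedly splitting off the smallest prime
-- factor (fuel n suffices, since each step at least halves n).
jacobi : ℕ → ℕ → ℤ
jacobi a n = go n n
  where
  go : ℕ → ℕ → ℤ
  go zero m = + 1
  go (suc fuel) m =
    if m ≤ᵇ 1 then + 1
    else (let q = smallestDivisor m in
          legendre a q ℤ.* go fuel (m / suc (q ℕ.∸ 1)))

{-# OPTIONS --safe #-}
module Submission where

-- Write pᵃ = n = 6m + 1, h = 3m = (n - 1)/2, K = 2m, so that ⌊5n/6⌋ = h + K, and let
-- G K x = ∑_{k ≤ K} (-1)ᵏ C(x + k, 2k).  Modulo p²,
--   C(2k, k)/16ᵏ ≡ (-1)ᵏ C(h + k, 2k)                     for k ≤ h,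
--   2 C(2k, k)/16ᵏ ≡ -(-1)ᵏ C(n + k - h, 2(k - h))        for h < k ≤ h + K,
-- so the sum is G h h - ½ (-1)ʰ (G K n - 1).  The recurrence
--   G K (x + 1) - G K x + G K (x - 1) = (-1)ᴷ C(x + K, 2K)
-- makes x ↦ G K x antiperiodic with period 3 up to boundary terms: it gives G h h = (-1)ᵐ and
-- the exact identity G K n = 2 G K (n - 1) - 1.  As also C(n - 1 + i, 2i) ≡ -C(n + i, 2i), i.e.
-- G K n - 1 ≡ -(G K (n - 1) - 1), this forces 3 (G K n - 1) ≡ 0, and the second half vanishes.
-- Finally (3/p) = (-1)^((p-1)/6) because -3 is a square mod p when p ≡ 1 (mod 3).

open import Defs

-- The obstacle is that `a` may exceed 1: the quotient of consecutive terms can then have numerator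
-- and denominator divisible by `p`, so a congruence cannot be carried from one `k` to the next by
-- division. Terms are therefore compared multiplicatively. For 0 < d < n, n has more factors `p`
-- than d, so d and d + c n have the same p-part and their quotient is a p-adic unit congruent to 1
-- mod `p`; such quotients can be multiplied along an induction. In the lower half the steps compare
-- d² - n² with d², which is precise to p². In the upper half only precision `p` is available, but
-- the terms there are themselves divisible by `p`, and this supplies the second factor. The symbol
-- (3/p) is evaluated without reciprocity: as -3 is a square, everything rests on the residue of `p`
-- mod 4.

module Proof where

  open import Data.Bool using (Bool; true; false; if_then_else_; T)
  open import Data.Empty using (⊥-elim)
  open import Data.Integer as ℤ using (ℤ; +_; -[1+_]; _+_; _*_; -_; _-_; _^_; 0ℤ; 1ℤ; -1ℤ; NonZero)
  open import Data.Integer.Divisibility.Signed using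
    ( _∣_; divides; _∣?_; ∣⇒∣ᵤ; ∣ᵤ⇒∣; ∣-refl; ∣-trans; ∣m∣n⇒∣m+n; ∣m∣n⇒∣m-n; ∣m+n∣n⇒∣m; ∣m⇒∣-m; ∣m⇒∣m*n; ∣n⇒∣m*n
    ; *-cancelˡ-∣)
  import Data.Integer.Properties as ℤ
  open import Data.Integer.Tactic.RingSolver using (solve-∀)
  open import Data.Nat as ℕ using (ℕ; zero; suc; z≤n; s≤s; _!; _≤ᵇ_; _≡ᵇ_)
  open import Data.Nat.Combinatorics using (_C_; nCn≡1; nCk≡nC[n∸k]; nCk+nC[k+1]≡[n+1]C[k+1])
  open import Data.Nat.Coprimality as Coprime using (Coprime; prime⇒coprime; coprime-divisor)
  import Data.Nat.DivMod as ℕ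
  import Data.Nat.Divisibility as ℕ∣
  open import Data.Nat.GCD using (gcd)
  open import Data.Nat.Primality using (Prime; euclidsLemma; prime⇒nonZero; prime⇒irreducible; ¬prime[1])
  import Data.Nat.Properties as ℕ
  open import Data.Nat.Tactic.RingSolver using () renaming (solve-∀ to ℕ-solve-∀)
  open import Data.Product using (_×_; _,_; ∃-syntax)
  open import Data.Rational as ℚ using (ℚ; ↧ₙ_)
  import Data.Rational.Properties as ℚ
  import Data.Rational.Unnormalised as ℚᵘ
  import Data.Rational.Unnormalised.Properties as ℚᵘ
  open import Data.Sum as Sum using (_⊎_; inj₁; inj₂; [_,_]′)
  open import Data.Unit using (tt)
  open import Function using (_∘_)
  open import Relation.Binary.PropositionalEquality using
    (_≡_; _≢_; refl; sym; trans; cong; cong₂; subst; subst₂; module ≡-Reasoning)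
  open import Relation.Nullary using (¬_; ¬?; yes; no; contradiction)
  open import Relation.Nullary.Decidable using (decidable-stable)
  open ≡-Reasoning

  -- Integer-valued binomial coefficients

  -- Pascal's rule holds by computation, and values in ℤ let signed identities go to the ring
  -- solver.
  binom : ℕ → ℕ → ℤ
  binom _       zero    = 1ℤ
  binom zero    (suc k) = 0ℤ
  binom (suc n) (suc k) = binom n k + binom n (suc k)

  binom≡C : ∀ n k → binom n k ≡ + (n C k)
  binom≡C n       zero    = cong +_ (sym (trans (nCk≡nC[n∸k] {0} {n} z≤n) (nCn≡1 n)))
  binom≡C zero    (suc k) = refl
  binom≡C (suc n) (suc k) = begin
    binom n k + binom n (suc k)  ≡⟨ cong₂ _+_ (binom≡C n k) (binom≡C n (suc k)) ⟩
    + (n C k ℕ.+ n C suc k)      ≡⟨ cong +_ (nCk+nC[k+1]≡[n+1]C[k+1] n k) ⟩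
    + (suc n C suc k)            ∎

  binom-sym : ∀ {n} j k → n ≡ j ℕ.+ k → binom n j ≡ binom n k
  binom-sym j k refl = begin
    binom (j ℕ.+ k) j               ≡⟨ binom≡C (j ℕ.+ k) j ⟩
    + ((j ℕ.+ k) C j)               ≡⟨ cong +_ (nCk≡nC[n∸k] (ℕ.m≤m+n j k)) ⟩
    + ((j ℕ.+ k) C (j ℕ.+ k ℕ.∸ j)) ≡⟨ cong (λ l → + ((j ℕ.+ k) C l)) (ℕ.m+n∸m≡n j k) ⟩
    + ((j ℕ.+ k) C k)               ≡⟨ binom≡C (j ℕ.+ k) k ⟨
    binom (j ℕ.+ k) k               ∎

  binom-zero : ∀ {n k} → n ℕ.< k → binom n k ≡ 0ℤ
  binom-zero {zero}  {suc k} _         = refl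
  binom-zero {suc n} {suc k} (s≤s n<k) = cong₂ _+_ (binom-zero n<k) (binom-zero (ℕ.m<n⇒m<1+n n<k))

  absorption : ∀ n k → + suc k * binom (suc n) (suc k) ≡ + suc n * binom n k
  absorption zero    zero    = refl
  absorption zero    (suc k) = ℤ.*-zeroʳ (+ suc (suc k))
  absorption (suc n) zero    = begin
    1ℤ * (1ℤ + binom (suc n) 1)           ≡⟨ ident (binom (suc n) 1) ⟩
    1ℤ + 1ℤ * binom (suc n) 1             ≡⟨ cong (_+_ 1ℤ) (absorption n 0) ⟩
    1ℤ + + suc n * 1ℤ                     ≡⟨ cong (_+_ 1ℤ) (ℤ.*-identityʳ (+ suc n)) ⟩
    + suc (suc n)                         ≡⟨ ℤ.*-identityʳ (+ suc (suc n)) ⟨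
    + suc (suc n) * 1ℤ                    ∎
    where
    ident : ∀ b → 1ℤ * (1ℤ + b) ≡ 1ℤ + 1ℤ * b
    ident = solve-∀
  absorption (suc n) (suc k) = begin
    + suc (suc k) * (binom (suc n) (suc k) + binom (suc n) (suc (suc k)))
      ≡⟨ ident₁ (+ suc k) (binom (suc n) (suc k)) (binom (suc n) (suc (suc k))) ⟩
    + suc k * binom (suc n) (suc k) + + suc (suc k) * binom (suc n) (suc (suc k)) + binom (suc n) (suc k)
      ≡⟨ cong₂ (λ x y → x + y + binom (suc n) (suc k)) (absorption n k) (absorption n (suc k)) ⟩
    + suc n * binom n k + + suc n * binom n (suc k) + (binom n k + binom n (suc k))
      ≡⟨ ident₂ (+ suc n) (binom n k) (binom n (suc k)) ⟩
    + suc (suc n) * (binom n k + binom n (suc k)) ∎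
    where
    ident₁ : ∀ k b c → (1ℤ + k) * (b + c) ≡ k * b + (1ℤ + k) * c + b
    ident₁ = solve-∀
    ident₂ : ∀ n b c → n * b + n * c + (b + c) ≡ (1ℤ + n) * (b + c)
    ident₂ = solve-∀

  -- The difference is taken in ℤ, so n < k is allowed: both sides then vanish.
  descent : ∀ n k → + suc k * binom n (suc k) ≡ (+ n - + k) * binom n k
  descent n k = begin
    + suc k * binom n (suc k)
      ≡⟨ ident₁ (+ suc k) (binom n k) (binom n (suc k)) ⟩
    + suc k * binom (suc n) (suc k) - + suc k * binom n k
      ≡⟨ cong (_- + suc k * binom n k) (absorption n k) ⟩
    + suc n * binom n k - + suc k * binom n k
      ≡⟨ ident₂ (+ n) (+ k) (binom n k) ⟩
    (+ n - + k) * binom n k ∎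
    where
    ident₁ : ∀ k b c → k * c ≡ k * (b + c) - k * b
    ident₁ = solve-∀
    ident₂ : ∀ n k b → (1ℤ + n) * b - (1ℤ + k) * b ≡ (n - k) * b
    ident₂ = solve-∀

  -- Absorption followed by descent. With upper index k + x and lower index 2k this is the step k ↦
  -- k + 1 of C(x + k, 2k).
  diagonal : ∀ n k → + suc k * + suc (suc k) * binom (suc n) (suc (suc k)) ≡ + suc n * (+ n - + k) * binom n k
  diagonal n k = begin
    + suc k * + suc (suc k) * binom (suc n) (suc (suc k))
      ≡⟨ ident₁ (+ suc k) (+ suc (suc k)) (binom (suc n) (suc (suc k))) ⟩
    + suc k * (+ suc (suc k) * binom (suc n) (suc (suc k)))
      ≡⟨ cong (+ suc k *_) (absorption n (suc k)) ⟩
    + suc k * (+ suc n * binom n (suc k))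
      ≡⟨ ident₂ (+ suc k) (+ suc n) (binom n (suc k)) ⟩
    + suc n * (+ suc k * binom n (suc k))
      ≡⟨ cong (+ suc n *_) (descent n k) ⟩
    + suc n * ((+ n - + k) * binom n k)
      ≡⟨ ident₃ (+ suc n) (+ n - + k) (binom n k) ⟩
    + suc n * (+ n - + k) * binom n k ∎
    where
    ident₁ : ∀ a b c → a * b * c ≡ a * (b * c)
    ident₁ = solve-∀
    ident₂ : ∀ a b c → a * (b * c) ≡ b * (a * c)
    ident₂ = solve-∀
    ident₃ : ∀ a b c → a * (b * c) ≡ a * b * c
    ident₃ = solve-∀

  -- `k ℕ.* 2`, unlike `2 ℕ.* k`, gains two successors when `k` becomes `suc k`, so Pascal's rule
  -- applies definitionally.
  central : ℕ → ℤ
  central k = binom (k ℕ.* 2) k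

  binom-middle : ∀ k → binom (suc (k ℕ.* 2)) (suc k) ≡ binom (suc (k ℕ.* 2)) k
  binom-middle k = binom-sym (suc k) k (cong suc (trans (ℕ.*-comm k 2) (cong (k ℕ.+_) (ℕ.+-identityʳ k))))

  central-step : ∀ k → + suc k * central (suc k) ≡ + 2 * + suc (k ℕ.* 2) * central k
  central-step k = begin
    + suc k * (binom (suc (k ℕ.* 2)) k + binom (suc (k ℕ.* 2)) (suc k))
      ≡⟨ cong (λ b → + suc k * (b + binom (suc (k ℕ.* 2)) (suc k))) (binom-middle k) ⟨
    + suc k * (binom (suc (k ℕ.* 2)) (suc k) + binom (suc (k ℕ.* 2)) (suc k))
      ≡⟨ ident₁ (+ suc k) (binom (suc (k ℕ.* 2)) (suc k)) ⟩
    + 2 * (+ suc k * binom (suc (k ℕ.* 2)) (suc k))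
      ≡⟨ cong (+ 2 *_) (absorption (k ℕ.* 2) k) ⟩
    + 2 * (+ suc (k ℕ.* 2) * central k)
      ≡⟨ ident₂ (+ suc (k ℕ.* 2)) (central k) ⟩
    + 2 * + suc (k ℕ.* 2) * central k ∎
    where
    ident₁ : ∀ a b → a * (b + b) ≡ + 2 * (a * b)
    ident₁ = solve-∀
    ident₂ : ∀ a b → + 2 * (a * b) ≡ + 2 * a * b
    ident₂ = solve-∀

  -- Alternating diagonal sums of Pascal's triangle

  sgn : ℕ → ℤ
  sgn zero    = 1ℤ
  sgn (suc k) = - sgn k

  sgn-even : ∀ m → sgn (m ℕ.* 2) ≡ 1ℤ
  sgn-even zero    = refl
  sgn-even (suc m) = trans (ℤ.neg-involutive _) (sgn-even m)

  sgn-*3 : ∀ m → sgn (m ℕ.* 3) ≡ sgn m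
  sgn-*3 zero    = refl
  sgn-*3 (suc m) = trans (ℤ.neg-involutive _) (cong -_ (sgn-*3 m))

  sgn-+ : ∀ m n → sgn (m ℕ.+ n) ≡ sgn m * sgn n
  sgn-+ zero    n = sym (ℤ.*-identityˡ (sgn n))
  sgn-+ (suc m) n = trans (cong -_ (sgn-+ m n)) (ℤ.neg-distribˡ-* (sgn m) (sgn n))

  ∑ : ℕ → (ℕ → ℤ) → ℤ
  ∑ zero    f = f 0
  ∑ (suc n) f = ∑ n f + f (suc n)

  -- Summand of the Morgan-Voyce polynomial ∑ C(x + k, 2k) yᵏ at y = -1, where its recurrence in x
  -- has characteristic polynomial X² - X + 1.
  diagTerm : ℕ → ℕ → ℤ
  diagTerm x k = sgn k * binom (k ℕ.+ x) (k ℕ.* 2)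

  -- For x ≤ K this is the 6-periodic sequence 1, 0, -1, -1, 0, 1, ... solving
  -- u (x + 2) = u (x + 1) - u x.
  G : ℕ → ℕ → ℤ
  G K x = ∑ K (diagTerm x)

  -- The second difference in x of the k-th binomial, centred at the middle argument, is the (k -
  -- 1)-st binomial there. Adding the middle value back makes the alternating sum telescope to its
  -- last term.
  G-recurrence : ∀ K x → G K (suc (suc x)) - G K (suc x) + G K x ≡ sgn K * binom (suc (K ℕ.+ x)) (K ℕ.* 2)
  G-recurrence zero    x = refl
  G-recurrence (suc K) x
    rewrite ℕ.+-suc K (suc x) | ℕ.+-suc K x = begin
    (G K (suc (suc x)) + - s * (a + b + (b + c))) - (G K (suc x) + - s * (b + c)) + (G K x + - s * c)
      ≡⟨ ident₁ (G K (suc (suc x))) (G K (suc x)) (G K x) s a b c ⟩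
    (G K (suc (suc x)) - G K (suc x) + G K x) - s * (a + b + c)
      ≡⟨ cong (_- s * (a + b + c)) (G-recurrence K x) ⟩
    s * a - s * (a + b + c)
      ≡⟨ ident₂ s a b c ⟩
    - s * (b + c) ∎
    where
    s = sgn K
    a = binom (suc (K ℕ.+ x)) (K ℕ.* 2)
    b = binom (suc (K ℕ.+ x)) (suc (K ℕ.* 2))
    c = binom (suc (K ℕ.+ x)) (suc (suc (K ℕ.* 2)))
    ident₁ : ∀ f g h s a b c →
      (f + - s * (a + b + (b + c))) - (g + - s * (b + c)) + (h + - s * c) ≡ (f - g + h) - s * (a + b + c)
    ident₁ = solve-∀
    ident₂ : ∀ s a b c → s * a - s * (a + b + c) ≡ - s * (b + c)
    ident₂ = solve-∀

  -- X³ + 1 = (X + 1)(X² - X + 1): adding the recurrence at two consecutive arguments cancels the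
  -- middle values.
  G-antiperiodic : ∀ K x → G K (suc (suc (suc x))) ≡
    - G K x + sgn K * (binom (suc (suc (K ℕ.+ x))) (K ℕ.* 2) + binom (suc (K ℕ.+ x)) (K ℕ.* 2))
  G-antiperiodic K x = begin
    G₃                                        ≡⟨ ident₁ G₀ G₁ G₂ G₃ ⟩
    - G₀ + ((G₃ - G₂ + G₁) + (G₂ - G₁ + G₀))  ≡⟨ cong₂ (λ a b → - G₀ + (a + b)) (G-recurrence K (suc x)) (G-recurrence K x) ⟩
    - G₀ + (sgn K * binom (suc (K ℕ.+ suc x)) (K ℕ.* 2) + sgn K * binom (suc (K ℕ.+ x)) (K ℕ.* 2))
      ≡⟨ cong (λ y → - G₀ + (sgn K * binom (suc y) (K ℕ.* 2) + sgn K * binom (suc (K ℕ.+ x)) (K ℕ.* 2))) (ℕ.+-suc K x) ⟩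
    - G₀ + (sgn K * binom (suc (suc (K ℕ.+ x))) (K ℕ.* 2) + sgn K * binom (suc (K ℕ.+ x)) (K ℕ.* 2))
      ≡⟨ cong (_+_ (- G₀)) (ℤ.*-distribˡ-+ (sgn K) _ _) ⟨
    - G₀ + sgn K * (binom (suc (suc (K ℕ.+ x))) (K ℕ.* 2) + binom (suc (K ℕ.+ x)) (K ℕ.* 2)) ∎
    where
    G₀ = G K x
    G₁ = G K (suc x)
    G₂ = G K (suc (suc x))
    G₃ = G K (suc (suc (suc x)))
    ident₁ : ∀ a b c d → d ≡ - a + ((d - c + b) + (c - b + a))
    ident₁ = solve-∀

  G-zero : ∀ K → G K 0 ≡ 1ℤ
  G-zero zero    = refl
  G-zero (suc K) = begin
    G K 0 + sgn (suc K) * binom (suc K ℕ.+ 0) (suc K ℕ.* 2)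
      ≡⟨ cong₂ (λ a b → a + sgn (suc K) * b) (G-zero K) (binom-zero (s≤s (s≤s K+0≤K*2))) ⟩
    1ℤ + sgn (suc K) * 0ℤ   ≡⟨ cong (_+_ 1ℤ) (ℤ.*-zeroʳ (sgn (suc K))) ⟩
    1ℤ ∎
    where
    K+0≤K*2 : K ℕ.+ 0 ℕ.≤ K ℕ.* 2
    K+0≤K*2 = subst (ℕ._≤ K ℕ.* 2) (sym (ℕ.+-identityʳ K)) (ℕ.m≤m*n K 2)

  -- Both boundary binomials of `G-antiperiodic` vanish, since x + 3 ≤ K keeps their upper indices
  -- below 2K.
  G-full : ∀ {K} m → m ℕ.* 3 ℕ.≤ K → G K (m ℕ.* 3) ≡ sgn m
  G-full {K} zero    _     = G-zero K
  G-full {K} (suc m) 3+x≤K = begin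
    G K (suc (suc (suc x)))
      ≡⟨ G-antiperiodic K x ⟩
    - G K x + sgn K * (binom (suc (suc (K ℕ.+ x))) (K ℕ.* 2) + binom (suc (K ℕ.+ x)) (K ℕ.* 2))
      ≡⟨ cong₂ (λ a b → - G K x + sgn K * (a + b)) (binom-zero 2+K+x<K*2) (binom-zero (ℕ.<-trans (ℕ.n<1+n _) 2+K+x<K*2)) ⟩
    - G K x + sgn K * 0ℤ
      ≡⟨ cong₂ (λ a b → - a + b) (G-full m (ℕ.≤-trans (ℕ.m≤n+m x 3) 3+x≤K)) (ℤ.*-zeroʳ (sgn K)) ⟩
    - sgn m + 0ℤ
      ≡⟨ ℤ.+-identityʳ (- sgn m) ⟩
    - sgn m ∎
    where
    x = m ℕ.* 3
    2+K+x<K*2 : suc (suc (K ℕ.+ x)) ℕ.< K ℕ.* 2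
    2+K+x<K*2 = subst (suc (suc (K ℕ.+ x)) ℕ.<_) (trans (cong (K ℕ.+_) (sym (ℕ.+-identityʳ K))) (ℕ.*-comm 2 K))
      (subst (ℕ._≤ K ℕ.+ K) (trans (ℕ.+-suc K (suc (suc x))) (cong suc (trans (ℕ.+-suc K (suc x)) (cong suc (ℕ.+-suc K x)))))
        (ℕ.+-monoʳ-≤ K 3+x≤K))

  -- Since C(4K+1, 2K) = C(4K+1, 2K+1) and C(4K+2, 2K) = C(4K+2, 2K+2), the boundary
  -- terms of G-antiperiodic cancel in this combination.
  G-doubling : ∀ K → G K (suc (K ℕ.* 3)) ≡ + 2 * G K (K ℕ.* 3) - sgn K
  G-doubling zero    = refl
  G-doubling (suc K)
    rewrite ℕ.+-suc K (suc (suc (suc (K ℕ.* 3)))) | ℕ.+-suc K (suc (suc (K ℕ.* 3)))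
          | ℕ.+-suc K (suc (K ℕ.* 3)) | ℕ.+-suc K (K ℕ.* 3) = begin
    G K (suc (suc (suc (suc x)))) + - s * (a₃ + b₃ + (b₃ + c₃))
      ≡⟨ cong (λ g → g + - s * (a₃ + b₃ + (b₃ + c₃))) (G-antiperiodic K (suc x)) ⟩
    - G K (suc x) + s * (binom (suc (suc (K ℕ.+ suc x))) j + binom (suc (K ℕ.+ suc x)) j) + - s * (a₃ + b₃ + (b₃ + c₃))
      ≡⟨ cong₂ (λ g y → - g + s * (binom (suc (suc y)) j + binom (suc y) j) + - s * (a₃ + b₃ + (b₃ + c₃)))
           (G-doubling K) (ℕ.+-suc K x) ⟩
    - (+ 2 * G K x - s) + s * (a₃ + a₂) + - s * (a₃ + b₃ + (b₃ + c₃))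
      ≡⟨ ident (G K x) s a₁ a₂ b₂ c₂ a₃ ⟩
    + 2 * ((- G K x + s * (a₂ + a₁)) + - s * (b₃ + c₃)) - - s
      + s * (c₂ - a₂) + s * (b₂ - + 2 * a₁)
      ≡⟨ cong₂ (λ u v → + 2 * ((- G K x + s * (a₂ + a₁)) + - s * (b₃ + c₃)) - - s + s * (u - a₂) + s * (a₁ + v - + 2 * a₁))
           (sym a₂≡c₂) (sym a₁≡b₁) ⟩
    + 2 * ((- G K x + s * (a₂ + a₁)) + - s * (b₃ + c₃)) - - s
      + s * (a₂ - a₂) + s * (a₁ + a₁ - + 2 * a₁)
      ≡⟨ ident₂ s a₁ a₂ (+ 2 * ((- G K x + s * (a₂ + a₁)) + - s * (b₃ + c₃))) ⟩
    + 2 * ((- G K x + s * (a₂ + a₁)) + - s * (b₃ + c₃)) - - s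
      ≡⟨ cong (λ g → + 2 * (g + - s * (b₃ + c₃)) - - s) (G-antiperiodic K x) ⟨
    + 2 * (G K (suc (suc (suc x))) + - s * (b₃ + c₃)) - - s ∎
    where
    x = K ℕ.* 3
    j = K ℕ.* 2
    s = sgn K
    n = suc (K ℕ.+ x)
    a₁ = binom n j
    a₂ = binom (suc n) j
    b₂ = binom (suc n) (suc j)
    c₂ = binom (suc n) (suc (suc j))
    a₃ = binom (suc (suc n)) j
    b₃ = binom (suc (suc n)) (suc j)
    c₃ = binom (suc (suc n)) (suc (suc j))
    n≡j+1+j : n ≡ suc j ℕ.+ j
    n≡j+1+j = cong suc (begin
      K ℕ.+ K ℕ.* 3          ≡⟨ ℕ.*-suc K 3 ⟨
      K ℕ.* 4                ≡⟨ ℕ.*-distribˡ-+ K 2 2 ⟩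
      j ℕ.+ j                ∎)
    a₁≡b₁ : a₁ ≡ binom n (suc j)
    a₁≡b₁ = sym (binom-sym (suc j) j n≡j+1+j)
    a₂≡c₂ : a₂ ≡ c₂
    a₂≡c₂ = sym (binom-sym (suc (suc j)) j (cong suc n≡j+1+j))
    ident : ∀ g s a₁ a₂ b₂ c₂ a₃ →
      - (+ 2 * g - s) + s * (a₃ + a₂) + - s * (a₃ + (a₂ + b₂) + ((a₂ + b₂) + (b₂ + c₂))) ≡
      + 2 * ((- g + s * (a₂ + a₁)) + - s * ((a₂ + b₂) + (b₂ + c₂))) - - s + s * (c₂ - a₂) + s * (b₂ - + 2 * a₁)
    ident = solve-∀
    ident₂ : ∀ s a b t → t - - s + s * (b - b) + s * (a + a - + 2 * a) ≡ t - - s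
    ident₂ = solve-∀

  -- Comparison of integers up to p-adic units close to 1

  -- `g` is the p-part of `d`. Because d < pᵃ, at least one factor `p` is left in pᵃ / g.
  prime-power-split : ∀ {p} a {d} → 0 ℕ.< d → d ℕ.< p ℕ.^ a →
    ∃[ g ] ∃[ u ] ∃[ w ] (d ≡ g ℕ.* u) × (p ℕ.^ a ≡ g ℕ.* (p ℕ.* w)) × ¬ (p ℕ∣.∣ u)
  prime-power-split zero {suc d} _ (s≤s ())
  prime-power-split {p} (suc a) {d} 0<d d<p^a with p ℕ∣.∣? d
  ... | no  p∤d = 1 , d , p ℕ.^ a , sym (ℕ.*-identityˡ d) , sym (ℕ.*-identityˡ _) , p∤d
  ... | yes (ℕ∣.divides d′ refl)
    with g , u , w , d≡ , n≡ , p∤u ← prime-power-split {p} a {d′}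
           (ℕ.>-nonZero⁻¹ d′ {{ℕ.m*n≢0⇒m≢0 d′ {{ℕ.>-nonZero 0<d}}}})
           (ℕ.*-cancelˡ-< p d′ (p ℕ.^ a) (subst (ℕ._< p ℕ.* p ℕ.^ a) (ℕ.*-comm d′ p) d<p^a))
    = p ℕ.* g , u , w
    , trans (cong (ℕ._* p) d≡) (trans (ℕ.*-comm (g ℕ.* u) p) (sym (ℕ.*-assoc p g u)))
    , trans (cong (p ℕ.*_) n≡) (sym (ℕ.*-assoc p g (p ℕ.* w)))
    , p∤u

  module Mod {p : ℕ} (p-prime : Prime p) where

    P : ℤ
    P = + p

    instance
      P≢0 : NonZero P
      P≢0 = prime⇒nonZero p-prime

    P-euclid : ∀ x y → P ∣ x * y → P ∣ x ⊎ P ∣ y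
    P-euclid x y P∣xy = Sum.map ∣ᵤ⇒∣ ∣ᵤ⇒∣
      (euclidsLemma ℤ.∣ x ∣ ℤ.∣ y ∣ p-prime (subst (p ℕ∣.∣_) (ℤ.abs-* x y) (∣⇒∣ᵤ P∣xy)))

    P-cancel : ∀ u {x} → ¬ P ∣ u → P ∣ u * x → P ∣ x
    P-cancel u P∤u P∣ux = [ (λ P∣u → ⊥-elim (P∤u P∣u)) , (λ P∣x → P∣x) ]′ (P-euclid u _ P∣ux)

    P²-cancel : ∀ u {x} → ¬ P ∣ u → P * P ∣ u * x → P * P ∣ x
    P²-cancel u {x} P∤u P²∣ux with P-cancel u P∤u (∣-trans (∣m⇒∣m*n P ∣-refl) P²∣ux)
    ... | divides y refl = subst (P * P ∣_) (ℤ.*-comm P y) (ℤ∣-*ˡ (P-cancel u P∤u (*-cancelˡ-∣ P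
            (subst (P * P ∣_) (ident u y P) P²∣ux))))
      where
      ident : ∀ u y q → u * (y * q) ≡ q * (u * y)
      ident = solve-∀
      ℤ∣-*ˡ : ∀ {z} → P ∣ z → P * P ∣ P * z
      ℤ∣-*ˡ (divides t refl) = divides t (ident₂ P t)
        where
        ident₂ : ∀ q t → q * (t * q) ≡ t * (q * q)
        ident₂ = solve-∀

    -- α/β is a p-adic unit congruent to 1 mod M.
    record Ratio (M α β : ℤ) : Set where
      constructor mkRatio
      field
        scale u v     : ℤ
        {{scale≢0}}   : NonZero scale
        α≡scale*u     : α ≡ scale * u
        β≡scale*v     : β ≡ scale * v
        M∣u-v         : M ∣ u - v
        P∤u           : ¬ P ∣ u

    -- Relative closeness: X / Y is the unit β / α. Cross-multiplication avoids inverting multiples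
    -- of `p`, and unlike a congruence the relation survives step factors that share powers of `p`.
    record Linked (M X Y : ℤ) : Set where
      constructor mkLinked
      field
        {α β} : ℤ
        ratio : Ratio M α β
        Xα≡Yβ : X * α ≡ Y * β

    ratio-* : ∀ {M α β α′ β′} → Ratio M α β → Ratio M α′ β′ → Ratio M (α * α′) (β * β′)
    ratio-* {M} (mkRatio g u v refl refl M∣u-v P∤u) (mkRatio g′ u′ v′ refl refl M∣u′-v′ P∤u′) =
      mkRatio (g * g′) (u * u′) (v * v′) {{ℤ.i*j≢0 g g′}} (ident₁ g u g′ u′) (ident₁ g v g′ v′)
        (subst (M ∣_) (ident₂ u v u′ v′) (∣m∣n⇒∣m+n (∣n⇒∣m*n u M∣u′-v′) (∣n⇒∣m*n v′ M∣u-v)))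
        (λ P∣uu′ → [ P∤u , P∤u′ ]′ (P-euclid u u′ P∣uu′))
      where
      ident₁ : ∀ a b c d → a * b * (c * d) ≡ a * c * (b * d)
      ident₁ = solve-∀
      ident₂ : ∀ u v u′ v′ → u * (u′ - v′) + v′ * (u - v) ≡ u * u′ - v * v′
      ident₂ = solve-∀

    ratio-scale : ∀ {M α β} c .{{_ : NonZero c}} → Ratio M α β → Ratio M (c * α) (c * β)
    ratio-scale c (mkRatio g u v refl refl M∣u-v P∤u) =
      mkRatio (c * g) u v {{ℤ.i*j≢0 c g}} (sym (ℤ.*-assoc c g u)) (sym (ℤ.*-assoc c g v)) M∣u-v P∤u

    linked-weaken : ∀ {M N X Y} → N ∣ M → Linked M X Y → Linked N X Y
    linked-weaken N∣M (mkLinked (mkRatio g u v α≡ β≡ M∣u-v P∤u) Xα≡Yβ) =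
      mkLinked (mkRatio g u v α≡ β≡ (∣-trans N∣M M∣u-v) P∤u) Xα≡Yβ

    -- The step multiplies X / Y by (B / D) / (B′ / D′), so only this quotient of the two step
    -- factors has to be a unit near 1.
    linked-step : ∀ {M X Y X′ Y′} D B D′ B′ → Linked M X Y → X′ * D ≡ X * B → Y′ * D′ ≡ Y * B′ →
      Ratio M (D * B′) (D′ * B) → Linked M X′ Y′
    linked-step {_} {X} {Y} {X′} {Y′} D B D′ B′ (mkLinked {α} {β} r Xα≡Yβ) X-step Y-step r′ =
      mkLinked (ratio-* r′ r) (begin
        X′ * (D * B′ * α)   ≡⟨ ident₁ X′ D B′ α ⟩
        X′ * D * B′ * α     ≡⟨ cong (λ z → z * B′ * α) X-step ⟩
        X * B * B′ * α      ≡⟨ ident₂ X B B′ α ⟩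
        X * α * B * B′      ≡⟨ cong (λ z → z * B * B′) Xα≡Yβ ⟩
        Y * β * B * B′      ≡⟨ ident₃ Y β B B′ ⟩
        Y * B′ * (B * β)    ≡⟨ cong (_* (B * β)) Y-step ⟨
        Y′ * D′ * (B * β)   ≡⟨ ident₄ Y′ D′ B β ⟩
        Y′ * (D′ * B * β)   ∎)
      where
      ident₁ : ∀ x d b a → x * (d * b * a) ≡ x * d * b * a
      ident₁ = solve-∀
      ident₂ : ∀ x d b a → x * d * b * a ≡ x * a * d * b
      ident₂ = solve-∀
      ident₃ : ∀ x d b a → x * d * b * a ≡ x * a * (b * d)
      ident₃ = solve-∀
      ident₄ : ∀ x d b a → x * d * (b * a) ≡ x * (d * b * a)
      ident₄ = solve-∀

    private
      -- After cancelling the scale, X u = Y v, so u (X - Y) = (v - u) Y: the relative precision M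
      -- and the divisor Q of Y multiply.
      linked-difference : ∀ {M X Y} Q → Linked M X Y → Q ∣ Y → ∃[ u ] ¬ (P ∣ u) × M * Q ∣ u * (X - Y)
      linked-difference {M} {X} Q (mkLinked (mkRatio g u v refl refl (divides t u-v≡tM) P∤u) Xα≡Yβ) (divides z refl) =
        u , P∤u , divides (- t * z) (begin
          u * (X - z * Q)                   ≡⟨ ident₁ u X (z * Q) ⟩
          X * u - z * Q * u                 ≡⟨ cong (_- z * Q * u) Xu≡Yv ⟩
          z * Q * v - z * Q * u             ≡⟨ ident₂ z Q u v ⟩
          - (u - v) * (z * Q)               ≡⟨ cong (λ w → - w * (z * Q)) u-v≡tM ⟩
          - (t * M) * (z * Q)               ≡⟨ ident₃ t M z Q ⟩
          - t * z * (M * Q)                 ∎)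
        where
        ident₀ : ∀ x g u → x * (g * u) ≡ x * u * g
        ident₀ = solve-∀
        ident₁ : ∀ u x y → u * (x - y) ≡ x * u - y * u
        ident₁ = solve-∀
        ident₂ : ∀ z q u v → z * q * v - z * q * u ≡ - (u - v) * (z * q)
        ident₂ = solve-∀
        ident₃ : ∀ t m z q → - (t * m) * (z * q) ≡ - t * z * (m * q)
        ident₃ = solve-∀
        Xu≡Yv : X * u ≡ z * Q * v
        Xu≡Yv = ℤ.*-cancelʳ-≡ (X * u) (z * Q * v) g
          (trans (sym (ident₀ X g u)) (trans Xα≡Yβ (ident₀ (z * Q) g v)))

    linked-P²⇒P² : ∀ {X Y} → Linked (P * P) X Y → P * P ∣ X - Y
    linked-P²⇒P² {X} {Y} l with u , P∤u , P²∣ ← linked-difference 1ℤ l (divides Y (sym (ℤ.*-identityʳ Y))) =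
      P²-cancel u P∤u (subst (_∣ u * (X - Y)) (ℤ.*-identityʳ (P * P)) P²∣)

    linked-P⇒P² : ∀ {X Y} → Linked P X Y → P ∣ Y → P * P ∣ X - Y
    linked-P⇒P² l P∣Y with u , P∤u , P²∣ ← linked-difference P l P∣Y = P²-cancel u P∤u P²∣

    module PrimePower (a : ℕ) {n : ℕ} (n≡p^a : n ≡ p ℕ.^ a) where

      ν : ℤ
      ν = + n

      private
        record Split (d : ℕ) : Set where
          field
            g u w       : ℤ
            g≢0         : NonZero g
            d≡gu        : + d ≡ g * u
            ν≡gPw       : ν ≡ g * (P * w)
            P∤u         : ¬ P ∣ u

        split : ∀ {d} → 0 ℕ.< d → d ℕ.< n → Split d
        split {d} 0<d d<n with g , u , w , d≡ , p^a≡ , p∤u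
          ← prime-power-split a 0<d (subst (d ℕ.<_) n≡p^a d<n) = record
          { g = + g ; u = + u ; w = + w
          ; g≢0 = ℕ.m*n≢0⇒m≢0 g {{subst ℕ.NonZero d≡ (ℕ.>-nonZero 0<d)}}
          ; d≡gu = trans (cong +_ d≡) (ℤ.pos-* g u)
          ; ν≡gPw = trans (cong +_ (trans n≡p^a p^a≡)) (trans (ℤ.pos-* g (p ℕ.* w)) (cong (+ g *_) (ℤ.pos-* p w)))
          ; P∤u = λ P∣u → p∤u (∣⇒∣ᵤ P∣u)
          }

      -- Once the p-part `g` of d is removed, both sides are congruent to the unit `u` mod `p`,
      -- because n / g is still divisible by `p`.
      ratio-shift : ∀ {d} b c → 0 ℕ.< d → d ℕ.< n → Ratio P (+ d + b * ν) (+ d + c * ν)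
      ratio-shift {d} b c 0<d d<n = mkRatio g (u + b * (P * w)) (u + c * (P * w)) {{g≢0}}
        (shift b) (shift c)
        (divides ((b - c) * w) (ident₂ u b c P w))
        (λ P∣u+ → P∤u (∣m+n∣n⇒∣m P∣u+ (∣n⇒∣m*n b (∣m⇒∣m*n w ∣-refl))))
        where
        open Split (split 0<d d<n)
        ident₁ : ∀ g u w b → g * u + b * (g * w) ≡ g * (u + b * w)
        ident₁ = solve-∀
        ident₂ : ∀ u b c q w → (u + b * (q * w)) - (u + c * (q * w)) ≡ (b - c) * w * q
        ident₂ = solve-∀
        shift : ∀ b → + d + b * ν ≡ g * (u + b * (P * w))
        shift b = trans (cong₂ (λ x y → x + b * y) d≡gu ν≡gPw) (ident₁ g u (P * w) b)

      -- In (d - n)(d + n) the terms linear in n cancel, which doubles the precision of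
      -- `ratio-shift`.
      ratio-square : ∀ {d} → 0 ℕ.< d → d ℕ.< n → Ratio (P * P) (+ d * + d - ν * ν) (+ d * + d)
      ratio-square {d} 0<d d<n = mkRatio (g * g) (u * u - P * w * (P * w)) (u * u) {{ℤ.i*j≢0 g g {{g≢0}} {{g≢0}}}}
        (trans (cong₂ (λ x y → x * x - y * y) d≡gu ν≡gPw) (ident₁ g u (P * w)))
        (trans (cong (λ x → x * x) d≡gu) (ident₂ g u))
        (divides (- (w * w)) (ident₃ u P w))
        (λ P∣ → [ P∤u , P∤u ]′ (P-euclid u u (∣m+n∣n⇒∣m P∣ (∣m⇒∣-m (∣m⇒∣m*n (P * w) (∣m⇒∣m*n w ∣-refl))))))
        where
        open Split (split 0<d d<n)
        ident₁ : ∀ g u w → g * u * (g * u) - g * w * (g * w) ≡ g * g * (u * u - w * w)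
        ident₁ = solve-∀
        ident₂ : ∀ g u → g * u * (g * u) ≡ g * g * (u * u)
        ident₂ = solve-∀
        ident₃ : ∀ u q w → u * u - q * w * (q * w) - u * u ≡ - (w * w) * (q * q)
        ident₃ = solve-∀

      -- In j C(n, j) = n C(n - 1, j - 1) the factor n has more factors `p` than j.
      P∣binom : ∀ {l} j → n ≡ suc l → 0 ℕ.< j → j ℕ.< n → P ∣ binom (suc l) j
      P∣binom {l} (suc j) n≡1+l 0<j j<n = P-cancel u P∤u (divides (w * binom l j)
        (ℤ.*-cancelˡ-≡ g _ _ {{g≢0}} (begin
          g * (u * binom (suc l) (suc j))   ≡⟨ ℤ.*-assoc g u _ ⟨
          g * u * binom (suc l) (suc j)     ≡⟨ cong (_* binom (suc l) (suc j)) d≡gu ⟨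
          + suc j * binom (suc l) (suc j)   ≡⟨ absorption l j ⟩
          + suc l * binom l j               ≡⟨ cong (_* binom l j) (trans (cong +_ (sym n≡1+l)) ν≡gPw) ⟩
          g * (P * w) * binom l j           ≡⟨ ident g P w (binom l j) ⟩
          g * (w * binom l j * P)           ∎)))
        where
        open Split (split 0<j j<n)
        ident : ∀ g q w b → g * (q * w) * b ≡ g * (w * b * q)
        ident = solve-∀

      -- Pascal's rule reduces row n + r to the columns j - r, ..., j of row n, and r < j < n keeps
      -- these away from both ends.
      P∣binom-shift : ∀ {l} r j → n ≡ suc l → r ℕ.< j → j ℕ.< n → P ∣ binom (r ℕ.+ suc l) j
      P∣binom-shift zero    j       n≡1+l 0<j       j<n = P∣binom j n≡1+l 0<j j<n
      P∣binom-shift (suc r) (suc j) n≡1+l (s≤s r<j) j<n =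
        ∣m∣n⇒∣m+n (P∣binom-shift r j n≡1+l r<j (ℕ.<-trans (ℕ.n<1+n j) j<n))
                  (P∣binom-shift r (suc j) n≡1+l (ℕ.m<n⇒m<1+n r<j) j<n)

  -- Step factors of the terms

  +[k*2] : ∀ k → + (k ℕ.* 2) ≡ + k * + 2
  +[k*2] k = ℤ.pos-* k 2

  -- The power of 16 moves the denominator of the original term to this side, so that the comparison
  -- is with the bare `central k` in ℤ.
  scaledTerm : ℕ → ℕ → ℤ
  scaledTerm x k = (+ 16) ^ k * diagTerm x k

  scaledTerm-step : ∀ x k → scaledTerm x (suc k) * (+ suc (k ℕ.* 2) * + suc (suc (k ℕ.* 2))) ≡
                            scaledTerm x k * (+ 16 * + suc (k ℕ.+ x) * (+ k - + x))
  scaledTerm-step x k = begin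
    + 16 * q * (- s * b′) * (+ suc (k ℕ.* 2) * + suc (suc (k ℕ.* 2)))
      ≡⟨ ident₁ q s b′ (+ suc (k ℕ.* 2)) (+ suc (suc (k ℕ.* 2))) ⟩
    - (+ 16 * q * s) * (+ suc (k ℕ.* 2) * + suc (suc (k ℕ.* 2)) * b′)
      ≡⟨ cong (- (+ 16 * q * s) *_) (diagonal (k ℕ.+ x) (k ℕ.* 2)) ⟩
    - (+ 16 * q * s) * (+ suc (k ℕ.+ x) * (+ k + + x - + (k ℕ.* 2)) * b)
      ≡⟨ cong (λ e → - (+ 16 * q * s) * (+ suc (k ℕ.+ x) * (+ k + + x - e) * b)) (+[k*2] k) ⟩
    - (+ 16 * q * s) * (+ suc (k ℕ.+ x) * (+ k + + x - + k * + 2) * b)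
      ≡⟨ ident₂ q s b (+ suc (k ℕ.+ x)) (+ k) (+ x) ⟩
    q * (s * b) * (+ 16 * + suc (k ℕ.+ x) * (+ k - + x)) ∎
    where
    q = (+ 16) ^ k
    s = sgn k
    b = binom (k ℕ.+ x) (k ℕ.* 2)
    b′ = binom (suc k ℕ.+ x) (suc k ℕ.* 2)
    ident₁ : ∀ q s b d e → + 16 * q * (- s * b) * (d * e) ≡ - (+ 16 * q * s) * (d * e * b)
    ident₁ = solve-∀
    ident₂ : ∀ q s b y k x → - (+ 16 * q * s) * (y * (k + x - k * + 2) * b) ≡ q * (s * b) * (+ 16 * y * (k - x))
    ident₂ = solve-∀

  scaledTerm-diagonal : ∀ h → scaledTerm h h ≡ (+ 16) ^ h * sgn h
  scaledTerm-diagonal h = cong ((+ 16) ^ h *_) (begin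
    sgn h * binom (h ℕ.+ h) (h ℕ.* 2)
      ≡⟨ cong (sgn h *_) (binom-sym (h ℕ.* 2) 0
           (trans (cong (h ℕ.+_) (sym (ℕ.+-identityʳ h))) (trans (ℕ.*-comm 2 h) (sym (ℕ.+-identityʳ _))))) ⟩
    sgn h * 1ℤ   ≡⟨ ℤ.*-identityʳ (sgn h) ⟩
    sgn h        ∎)

  -- `central-step` expanded by 2k + 1: the denominator becomes that of `scaledTerm-step`, and the
  -- numerator becomes the square needed for `ratio-square`.
  central-step² : ∀ k → central (suc k) * (+ suc (k ℕ.* 2) * + suc (suc (k ℕ.* 2))) ≡
                        central k * (+ 4 * (+ suc (k ℕ.* 2) * + suc (k ℕ.* 2)))
  central-step² k = begin
    central (suc k) * (+ suc (k ℕ.* 2) * (+ 2 + + (k ℕ.* 2)))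
      ≡⟨ cong (λ e → central (suc k) * (+ suc (k ℕ.* 2) * (+ 2 + e))) (+[k*2] k) ⟩
    central (suc k) * (+ suc (k ℕ.* 2) * (+ 2 + + k * + 2))
      ≡⟨ ident₁ (central (suc k)) (+ suc (k ℕ.* 2)) (+ k) ⟩
    + 2 * + suc (k ℕ.* 2) * (+ suc k * central (suc k))
      ≡⟨ cong (+ 2 * + suc (k ℕ.* 2) *_) (central-step k) ⟩
    + 2 * + suc (k ℕ.* 2) * (+ 2 * + suc (k ℕ.* 2) * central k)
      ≡⟨ ident₂ (+ suc (k ℕ.* 2)) (central k) ⟩
    central k * (+ 4 * (+ suc (k ℕ.* 2) * + suc (k ℕ.* 2))) ∎
    where
    ident₁ : ∀ c d k → c * (d * (+ 2 + k * + 2)) ≡ + 2 * d * ((1ℤ + k) * c)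
    ident₁ = solve-∀
    ident₂ : ∀ d c → + 2 * d * (+ 2 * d * c) ≡ c * (+ 4 * (d * d))
    ident₂ = solve-∀

  binom-upper : ∀ n j → binom n j * + suc n ≡ binom (suc n) j * (+ suc n - + j)
  binom-upper n zero    = cong (1ℤ *_) (sym (ℤ.+-identityʳ (+ suc n)))
  binom-upper n (suc j) = begin
    binom n (suc j) * + suc n
      ≡⟨ ident₁ (binom n j) (binom n (suc j)) (+ suc n) ⟩
    binom (suc n) (suc j) * + suc n - + suc n * binom n j
      ≡⟨ cong (λ e → binom (suc n) (suc j) * + suc n - e) (absorption n j) ⟨
    binom (suc n) (suc j) * + suc n - + suc j * binom (suc n) (suc j)
      ≡⟨ ident₂ (binom (suc n) (suc j)) (+ suc n) (+ suc j) ⟩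
    binom (suc n) (suc j) * (+ suc n - + suc j) ∎
    where
    ident₁ : ∀ a b n → b * n ≡ (a + b) * n - n * a
    ident₁ = solve-∀
    ident₂ : ∀ c n j → c * n - j * c ≡ c * (n - j)
    ident₂ = solve-∀

  -- 16ᵏ times the partial sum, in Horner form, so that the congruence can be proved in ℤ.
  scaledSum : ℕ → ℤ
  scaledSum zero    = 1ℤ
  scaledSum (suc k) = + 16 * scaledSum k + central (suc k)

  -- The congruence modulo p² over ℤ

  module Supercongruence {p : ℕ} (p-prime : Prime p) (3<p : 3 ℕ.< p) (a m : ℕ)
    (n≡p^a : suc (m ℕ.* 2 ℕ.* 3) ≡ p ℕ.^ a) where

    K h n : ℕ
    K = m ℕ.* 2
    h = m ℕ.* 3
    n = suc (K ℕ.* 3)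

    open Mod p-prime
    open PrimePower a n≡p^a

    η s : ℤ
    η = + h
    s = (+ 16) ^ h * sgn h

    h*2≡K*3 : h ℕ.* 2 ≡ K ℕ.* 3
    h*2≡K*3 = trans (ℕ.*-assoc m 3 2) (sym (ℕ.*-assoc m 2 3))

    ν≡1+2η : ν ≡ 1ℤ + η * + 2
    ν≡1+2η = trans (cong (λ l → + suc l) (sym h*2≡K*3)) (cong (_+_ 1ℤ) (+[k*2] h))

    P∤small : ∀ {c} .{{_ : ℕ.NonZero c}} → c ℕ.≤ 3 → ¬ P ∣ + c
    P∤small c≤3 P∣c = ℕ.<⇒≱ (ℕ.≤-<-trans c≤3 3<p) (ℕ∣.∣⇒≤ (∣⇒∣ᵤ P∣c))

    ratio-1 : ∀ {M} → Ratio M 1ℤ 1ℤ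
    ratio-1 = mkRatio 1ℤ 1ℤ 1ℤ refl refl (divides 0ℤ refl) (P∤small (s≤s z≤n))

    -- As n = 2h + 1, the factor 16 (k + h + 1)(k - h) equals 4 ((2k + 1)² - n²), to be compared
    -- with 4 (2k + 1)². For k < h one has 2k + 1 < n, so `ratio-square` applies.
    central-lower : ∀ k → k ℕ.≤ h → Linked (P * P) (central k) (scaledTerm h k)
    central-lower zero    _   = mkLinked ratio-1 refl
    central-lower (suc k) k<h =
      linked-step D (+ 4 * (d * d)) D (+ 16 * + suc (k ℕ.+ h) * (+ k - η))
        (central-lower k (ℕ.<⇒≤ k<h)) (central-step² k) (scaledTerm-step h k)
        (subst (λ e → Ratio _ (D * e) (D * (+ 4 * (d * d)))) (sym step-factor)
          (ratio-scale D (ratio-scale (+ 4) (ratio-square (s≤s z≤n) d<n))))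
      where
      d D : ℤ
      d = + suc (k ℕ.* 2)
      D = d * + suc (suc (k ℕ.* 2))
      instance
        D≢0 : NonZero D
        D≢0 = ℤ.i*j≢0 d (+ suc (suc (k ℕ.* 2)))
      d<n : suc (k ℕ.* 2) ℕ.< n
      d<n = s≤s (subst (k ℕ.* 2 ℕ.<_) h*2≡K*3 (ℕ.*-monoˡ-< 2 k<h))
      ident : ∀ k h → + 16 * (1ℤ + (k + h)) * (k - h) ≡
                      + 4 * ((1ℤ + k * + 2) * (1ℤ + k * + 2) - (1ℤ + h * + 2) * (1ℤ + h * + 2))
      ident = solve-∀
      step-factor : + 16 * + suc (k ℕ.+ h) * (+ k - η) ≡ + 4 * (d * d - ν * ν)
      step-factor = trans (ident (+ k) η) (cong₂ (λ d v → + 4 * (d * d - v * v)) (cong (_+_ 1ℤ) (sym (+[k*2] k))) (sym ν≡1+2η))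

    double<n : ∀ {i} → i ℕ.≤ K → i ℕ.* 2 ℕ.< n
    double<n i≤K = s≤s (ℕ.≤-trans (ℕ.*-monoˡ-≤ 2 i≤K) (ℕ.*-monoʳ-≤ K (s≤s (s≤s z≤n))))

    central-upper-step : ∀ i →
      + 2 * central (suc i ℕ.+ h) * (1ℤ + + i * + 2 + ν) ≡ + 2 * central (i ℕ.+ h) * (+ 4 * (+ i * + 2 + ν))
    central-upper-step i = begin
      + 2 * c′ * (1ℤ + + i * + 2 + ν)
        ≡⟨ cong (λ v → + 2 * c′ * (1ℤ + + i * + 2 + v)) ν≡1+2η ⟩
      + 2 * c′ * (1ℤ + + i * + 2 + (1ℤ + η * + 2))
        ≡⟨ ident₁ c′ (+ i) η ⟩
      + 4 * ((1ℤ + (+ i + η)) * c′)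
        ≡⟨ cong (+ 4 *_) (central-step (i ℕ.+ h)) ⟩
      + 4 * (+ 2 * (1ℤ + + ((i ℕ.+ h) ℕ.* 2)) * c)
        ≡⟨ cong (λ e → + 4 * (+ 2 * (1ℤ + e) * c)) (+[k*2] (i ℕ.+ h)) ⟩
      + 4 * (+ 2 * (1ℤ + (+ i + η) * + 2) * c)
        ≡⟨ ident₂ c (+ i) η ⟩
      + 2 * c * (+ 4 * (+ i * + 2 + (1ℤ + η * + 2)))
        ≡⟨ cong (λ v → + 2 * c * (+ 4 * (+ i * + 2 + v))) ν≡1+2η ⟨
      + 2 * c * (+ 4 * (+ i * + 2 + ν)) ∎
      where
      c = central (i ℕ.+ h)
      c′ = central (suc i ℕ.+ h)
      ident₁ : ∀ c i h → + 2 * c * (1ℤ + i * + 2 + (1ℤ + h * + 2)) ≡ + 4 * ((1ℤ + (i + h)) * c)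
      ident₁ = solve-∀
      ident₂ : ∀ c i h → + 4 * (+ 2 * (1ℤ + (i + h) * + 2) * c) ≡ + 2 * c * (+ 4 * (i * + 2 + (1ℤ + h * + 2)))
      ident₂ = solve-∀

    -- The step factors contain 2i + n on one side and 2 (i - n) on the other. For i > 0 their
    -- quotient is near 1, but at i = 0 they are n and -2n. Hence the sign and the factor 2, and an
    -- induction that starts at index 1.
    central-upper : ∀ i → suc i ℕ.≤ K → Linked P (+ 2 * central (suc i ℕ.+ h)) (- (s * scaledTerm n (suc i)))
    central-upper zero 1≤K =
      linked-step (1ℤ + 0ℤ + ν) (+ 8 * ν) (+ 2) (+ 16 * ν * (1ℤ + ν)) (linked-weaken (divides P refl) (central-lower h ℕ.≤-refl))
        (trans (central-upper-step 0) (ident₁ (central h) ν))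
        (begin
          - (s * scaledTerm n 1) * + 2        ≡⟨ ident₂ s (scaledTerm n 1) ⟩
          - s * (scaledTerm n 1 * + 2)        ≡⟨ cong (- s *_) (scaledTerm-step n 0) ⟩
          - s * (1ℤ * (+ 16 * (1ℤ + ν) * (0ℤ - ν))) ≡⟨ ident₃ s ν ⟩
          s * (+ 16 * ν * (1ℤ + ν)) ≡⟨ cong (_* (+ 16 * ν * (1ℤ + ν))) (scaledTerm-diagonal h) ⟨
          scaledTerm h h * (+ 16 * ν * (1ℤ + ν)) ∎)
        -- The common factor 16 ν cancels and leaves (1 + ν)² against 1.
        (subst₂ (Ratio P) (ident₄ ν) (ident₅ ν) (ratio-scale (+ 16 * ν) {{ℤ.i*j≢0 (+ 16) ν}} (ratio-* r₁ r₁)))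
      where
      r₁ = ratio-shift {1} 1ℤ 0ℤ (s≤s z≤n) (ℕ.≤-<-trans (s≤s z≤n) (double<n 1≤K))
      ident₁ : ∀ c v → + 2 * c * (+ 4 * (0ℤ + v)) ≡ c * (+ 8 * v)
      ident₁ = solve-∀
      ident₂ : ∀ s e → - (s * e) * + 2 ≡ - s * (e * + 2)
      ident₂ = solve-∀
      ident₃ : ∀ s v → - s * (1ℤ * (+ 16 * (1ℤ + v) * (0ℤ - v))) ≡ s * (+ 16 * v * (1ℤ + v))
      ident₃ = solve-∀
      ident₄ : ∀ v → + 16 * v * ((1ℤ + 1ℤ * v) * (1ℤ + 1ℤ * v)) ≡ (1ℤ + 0ℤ + v) * (+ 16 * v * (1ℤ + v))
      ident₄ = solve-∀
      ident₅ : ∀ v → + 16 * v * ((1ℤ + 0ℤ * v) * (1ℤ + 0ℤ * v)) ≡ + 2 * (+ 8 * v)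
      ident₅ = solve-∀
    central-upper (suc i) 1+j≤K =
      linked-step (1ℤ + + j * + 2 + ν) (+ 4 * (+ j * + 2 + ν)) D′ B′
        (central-upper i (ℕ.<⇒≤ 1+j≤K)) (central-upper-step j)
        (begin
          - (s * scaledTerm n (suc j)) * D′     ≡⟨ ident₁ s (scaledTerm n (suc j)) D′ ⟩
          - s * (scaledTerm n (suc j) * D′)     ≡⟨ cong (- s *_) (scaledTerm-step n j) ⟩
          - s * (scaledTerm n j * B′)           ≡⟨ ident₂ s (scaledTerm n j) B′ ⟩
          - (s * scaledTerm n j) * B′           ∎)
        (subst₂ (Ratio P)
          (trans (cong (λ e → + 8 * ((1ℤ + e + 1ℤ * ν) * ((1ℤ + + j + 1ℤ * ν) * (e + - + 2 * ν)))) (+[k*2] j)) (ident₃ (+ j) ν))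
          (trans (cong (λ e → + 8 * ((1ℤ + e + 0ℤ * ν) * ((1ℤ + + j + 0ℤ * ν) * (e + 1ℤ * ν)))) (+[k*2] j))
            (trans (ident₄ (+ j) ν)
             (cong (λ e → (1ℤ + e) * (+ 2 + e) * (+ 4 * (+ j * + 2 + ν))) (sym (+[k*2] j)))))
          -- Up to the common 8 the step compares 2j + 1 + n with 2j + 1, j + 1 + n with j + 1, and
          -- 2j - 2n with 2j + n.
          (ratio-scale (+ 8) (ratio-* (ratio-shift {suc (j ℕ.* 2)} 1ℤ 0ℤ (s≤s z≤n) (ℕ.<-trans (ℕ.n<1+n _) 2+2j<n))
             (ratio-* (ratio-shift {suc j} 1ℤ 0ℤ (s≤s z≤n) (ℕ.≤-<-trans (s≤s (ℕ.m≤m*n j 2)) (ℕ.<-trans (ℕ.n<1+n _) 2+2j<n)))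
                      (ratio-shift {j ℕ.* 2} (- + 2) 1ℤ (s≤s z≤n) (ℕ.<-trans (ℕ.n<1+n _) (ℕ.<-trans (ℕ.n<1+n _) 2+2j<n)))))))
      where
      j = suc i
      D′ = + suc (j ℕ.* 2) * + suc (suc (j ℕ.* 2))
      B′ = + 16 * + suc (j ℕ.+ n) * (+ j - ν)
      2+2j<n : suc (suc (j ℕ.* 2)) ℕ.< n
      2+2j<n = double<n 1+j≤K
      ident₁ : ∀ s e d → - (s * e) * d ≡ - s * (e * d)
      ident₁ = solve-∀
      ident₂ : ∀ s e d → - s * (e * d) ≡ - (s * e) * d
      ident₂ = solve-∀
      ident₃ : ∀ j v → + 8 * ((1ℤ + j * + 2 + 1ℤ * v) * ((1ℤ + j + 1ℤ * v) * (j * + 2 + - + 2 * v))) ≡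
        (1ℤ + j * + 2 + v) * (+ 16 * (1ℤ + (j + v)) * (j - v))
      ident₃ = solve-∀
      ident₄ : ∀ j v → + 8 * ((1ℤ + j * + 2 + 0ℤ * v) * ((1ℤ + j + 0ℤ * v) * (j * + 2 + 1ℤ * v))) ≡
        (1ℤ + j * + 2) * (+ 2 + j * + 2) * (+ 4 * (j * + 2 + v))
      ident₄ = solve-∀

    -- From C(n - 1 + i, 2i)(i + n) = -C(n + i, 2i)(i - n): the quotient (i + n) / (i - n) is near 1
    -- only mod `p`, and the binomial contributes the other factor `p`.
    adjacent : ∀ i → 0 ℕ.< i → i ℕ.≤ K → P * P ∣ diagTerm n i + diagTerm (K ℕ.* 3) i
    adjacent i 0<i i≤K = subst (P * P ∣_) (ident₁ (sgn i) b b′)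
        (∣n⇒∣m*n (sgn i) (linked-P⇒P² {b′} { - b} (mkLinked r (begin
          b′ * (+ i + 1ℤ * ν)
            ≡⟨ cong (b′ *_) (ident₂ (+ i) ν) ⟩
          b′ * (+ i + ν)
            ≡⟨ cong (λ l → b′ * + l) (ℕ.+-suc i (K ℕ.* 3)) ⟩
          b′ * + suc (i ℕ.+ K ℕ.* 3)
            ≡⟨ binom-upper (i ℕ.+ K ℕ.* 3) (i ℕ.* 2) ⟩
          binom (suc (i ℕ.+ K ℕ.* 3)) (i ℕ.* 2) * (+ suc (i ℕ.+ K ℕ.* 3) - + (i ℕ.* 2))
            ≡⟨ cong₂ (λ l e → binom l (i ℕ.* 2) * (+ l - e)) (sym (ℕ.+-suc i (K ℕ.* 3))) (+[k*2] i) ⟩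
          b * (+ i + ν - + i * + 2)
            ≡⟨ ident₃ b (+ i) ν ⟩
          - b * (+ i + -1ℤ * ν) ∎)) (∣m⇒∣-m (P∣b))))
      where
      b = binom (i ℕ.+ n) (i ℕ.* 2)
      b′ = binom (i ℕ.+ K ℕ.* 3) (i ℕ.* 2)
      i<2i : i ℕ.< i ℕ.* 2
      i<2i = ℕ.m<m*n i 2 {{ℕ.>-nonZero 0<i}} (s≤s (s≤s z≤n))
      r = ratio-shift {i} 1ℤ -1ℤ 0<i (ℕ.<-trans i<2i (double<n i≤K))
      P∣b : P ∣ b
      P∣b = P∣binom-shift i (i ℕ.* 2) refl i<2i (double<n i≤K)
      ident₁ : ∀ s b b′ → s * (b′ - - b) ≡ s * b + s * b′
      ident₁ = solve-∀
      ident₂ : ∀ i v → i + 1ℤ * v ≡ i + v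
      ident₂ = solve-∀
      ident₃ : ∀ b i v → b * (i + v - i * + 2) ≡ - b * (i + -1ℤ * v)
      ident₃ = solve-∀

    -- The constant 2 comes from the two summands at k = 0, both equal to 1.
    G-adjacent : ∀ i → i ℕ.≤ K → P * P ∣ G i n + G i (K ℕ.* 3) - + 2
    G-adjacent zero    _   = divides 0ℤ refl
    G-adjacent (suc i) i<K = subst (P * P ∣_)
        (ident (G i n) (G i (K ℕ.* 3)) (diagTerm n (suc i)) (diagTerm (K ℕ.* 3) (suc i)))
        (∣m∣n⇒∣m+n (G-adjacent i (ℕ.<⇒≤ i<K)) (adjacent (suc i) (s≤s z≤n) i<K))
      where
      ident : ∀ g g′ d d′ → (g + g′ - + 2) + (d + d′) ≡ (g + d) + (g′ + d′) - + 2
      ident = solve-∀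

    -- G-doubling and G-adjacent are two independent linear relations mod p² between
    -- G K n - 1 and G K (n - 1) - 1, with determinant 3.
    G-upper : P * P ∣ G K n - 1ℤ
    G-upper = P²-cancel (+ 3) (P∤small ℕ.≤-refl) (subst (P * P ∣_) (begin
        + 2 * (G K n + G′ - + 2)                    ≡⟨ ident₁ (G K n) G′ 1ℤ ⟩
        + 2 * G K n + (+ 2 * G′ - 1ℤ) - + 3         ≡⟨ cong (λ e → + 2 * G K n + (+ 2 * G′ - e) - + 3) (sgn-even m) ⟨
        + 2 * G K n + (+ 2 * G′ - sgn K) - + 3      ≡⟨ cong (λ e → + 2 * G K n + e - + 3) (G-doubling K) ⟨
        + 2 * G K n + G K n - + 3                   ≡⟨ ident₂ (G K n) ⟩
        + 3 * (G K n - 1ℤ)                          ∎)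
        (∣n⇒∣m*n (+ 2) (G-adjacent K ℕ.≤-refl)))
      where
      G′ = G K (K ℕ.* 3)
      ident₁ : ∀ g g′ e → + 2 * (g + g′ - + 2) ≡ + 2 * g + (+ 2 * g′ - e) - (+ 4 - e)
      ident₁ = solve-∀
      ident₂ : ∀ g → + 2 * g + g - + 3 ≡ + 3 * (g - 1ℤ)
      ident₂ = solve-∀

    scaledSum-lower : ∀ k → k ℕ.≤ h → P * P ∣ scaledSum k - (+ 16) ^ k * G k h
    scaledSum-lower zero    _   = divides 0ℤ refl
    scaledSum-lower (suc k) k<h = subst (P * P ∣_)
        (ident (scaledSum k) ((+ 16) ^ k) (G k h) (central (suc k)) (diagTerm h (suc k)))
        (∣m∣n⇒∣m+n (∣n⇒∣m*n (+ 16) (scaledSum-lower k (ℕ.<⇒≤ k<h))) (linked-P²⇒P² (central-lower (suc k) k<h)))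
      where
      ident : ∀ f q g c d → + 16 * (f - q * g) + (c - + 16 * q * d) ≡ (+ 16 * f + c) - + 16 * q * (g + d)
      ident = solve-∀

    -- The -1 next to `G i n` removes its summand k = 0, since the upper half starts one step after
    -- index `h`. Everything is doubled to keep the factor ½ out of ℤ.
    scaledSum-upper : ∀ i → i ℕ.≤ K →
      P * P ∣ + 2 * scaledSum (i ℕ.+ h) - (+ 16) ^ i * (+ 2 * scaledSum h - s * (G i n - 1ℤ))
    scaledSum-upper zero    _   = divides 0ℤ (ident (scaledSum h) s (P * P))
      where
      ident : ∀ f s q → + 2 * f - 1ℤ * (+ 2 * f - s * 0ℤ) ≡ 0ℤ * q
      ident = solve-∀
    scaledSum-upper (suc i) i<K = subst (P * P ∣_)
        (ident (scaledSum (i ℕ.+ h)) ((+ 16) ^ i) (scaledSum h) s (G i n) (central (suc i ℕ.+ h)) (diagTerm n (suc i)))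
        (∣m∣n⇒∣m+n (∣n⇒∣m*n (+ 16) (scaledSum-upper i (ℕ.<⇒≤ i<K)))
          (linked-P⇒P² (central-upper i i<K)
            (∣m⇒∣-m (∣n⇒∣m*n s (∣n⇒∣m*n ((+ 16) ^ suc i) (∣n⇒∣m*n (sgn (suc i))
              (P∣binom-shift (suc i) (suc i ℕ.* 2) refl (ℕ.m<m*n (suc i) 2 (s≤s (s≤s z≤n))) (double<n i<K))))))))
      where
      ident : ∀ f q f₀ s g c d →
        + 16 * (+ 2 * f - q * (+ 2 * f₀ - s * (g - 1ℤ))) + (+ 2 * c - - (s * (+ 16 * q * d))) ≡
        + 2 * (+ 16 * f + c) - + 16 * q * (+ 2 * f₀ - s * ((g + d) - 1ℤ))
      ident = solve-∀

    scaledSum-congruence : P * P ∣ scaledSum (m ℕ.* 5) - (+ 16) ^ (m ℕ.* 5) * sgn m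
    scaledSum-congruence = P²-cancel (+ 2) (P∤small (s≤s (s≤s z≤n))) (subst (P * P ∣_)
        (trans (ident (scaledSum (K ℕ.+ h)) (scaledSum h) ((+ 16) ^ K) ((+ 16) ^ h) (sgn m) s (G K n))
          (trans (cong (λ e → + 2 * (scaledSum (K ℕ.+ h) - e * sgn m)) (sym (ℤ.^-distribˡ-+-* (+ 16) K h)))
            (cong (λ l → + 2 * (scaledSum l - (+ 16) ^ l * sgn m)) (sym (ℕ.*-distribˡ-+ m 2 3)))))
        (∣m∣n⇒∣m-n (∣m∣n⇒∣m+n (scaledSum-upper K ℕ.≤-refl)
            (∣n⇒∣m*n (+ 2 * (+ 16) ^ K) (subst (λ g → P * P ∣ scaledSum h - (+ 16) ^ h * g) (G-full m ℕ.≤-refl)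
              (scaledSum-lower h ℕ.≤-refl))))
          (∣n⇒∣m*n ((+ 16) ^ K * s) G-upper)))
      where
      ident : ∀ f f₀ q q₀ e s g →
        (+ 2 * f - q * (+ 2 * f₀ - s * (g - 1ℤ))) + + 2 * q * (f₀ - q₀ * e) - q * s * (g - 1ℤ) ≡
        + 2 * (f - q * q₀ * e)
      ident = solve-∀

  -- Passage from ℤ to ℚ

  /-cong-× : ∀ i j m n .{{_ : ℕ.NonZero m}} .{{_ : ℕ.NonZero n}} → i * + n ≡ j * + m → i ℚ./ m ≡ j ℚ./ n
  /-cong-× i j (suc m) (suc n) eq = ℚ.fromℚᵘ-cong {ℚᵘ.mkℚᵘ i m} {ℚᵘ.mkℚᵘ j n} (ℚᵘ.*≡* eq)

  /-+ : ∀ i j m n .{{_ : ℕ.NonZero m}} .{{_ : ℕ.NonZero n}} →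
    i ℚ./ m ℚ.+ j ℚ./ n ≡ ((i * + n + j * + m) ℚ./ (m ℕ.* n)) {{ℕ.m*n≢0 m n}}
  /-+ i j (suc m) (suc n) = ℚ.toℚᵘ-injective (ℚᵘ.≃-trans (ℚ.toℚᵘ-homo-+ (i ℚ./ suc m) (j ℚ./ suc n))
    (ℚᵘ.≃-trans (ℚᵘ.+-cong (ℚ.toℚᵘ-fromℚᵘ (ℚᵘ.mkℚᵘ i m)) (ℚ.toℚᵘ-fromℚᵘ (ℚᵘ.mkℚᵘ j n)))
      (ℚᵘ.≃-sym (ℚ.toℚᵘ-fromℚᵘ (ℚᵘ.mkℚᵘ i m ℚᵘ.+ ℚᵘ.mkℚᵘ j n)))))

  /-* : ∀ i j m n .{{_ : ℕ.NonZero m}} .{{_ : ℕ.NonZero n}} →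
    (i ℚ./ m) ℚ.* (j ℚ./ n) ≡ ((i * j) ℚ./ (m ℕ.* n)) {{ℕ.m*n≢0 m n}}
  /-* i j (suc m) (suc n) = ℚ.toℚᵘ-injective (ℚᵘ.≃-trans (ℚ.toℚᵘ-homo-* (i ℚ./ suc m) (j ℚ./ suc n))
    (ℚᵘ.≃-trans (ℚᵘ.*-cong (ℚ.toℚᵘ-fromℚᵘ (ℚᵘ.mkℚᵘ i m)) (ℚ.toℚᵘ-fromℚᵘ (ℚᵘ.mkℚᵘ j n)))
      (ℚᵘ.≃-sym (ℚ.toℚᵘ-fromℚᵘ (ℚᵘ.mkℚᵘ i m ℚᵘ.* ℚᵘ.mkℚᵘ j n)))))

  pos-^ : ∀ x n → + (x ℕ.^ n) ≡ (+ x) ^ n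
  pos-^ x zero    = refl
  pos-^ x (suc n) = trans (ℤ.pos-* x (x ℕ.^ n)) (cong (+ x *_) (pos-^ x n))

  infixl 7 _/16^_
  _/16^_ : ℤ → ℕ → ℚ
  i /16^ k = (i ℚ./ 16 ℕ.^ k) {{ℕ.m^n≢0 16 k}}

  term≡central : ∀ k → term k ≡ central k /16^ k
  term≡central k = ℚ./-cong (trans (cong (λ n → + (n C k)) (ℕ.*-comm 2 k)) (sym (binom≡C (k ℕ.* 2) k))) refl
    where instance
      _ = ℕ.m^n≢0 16 k

  sumℚ≡scaledSum : ∀ k → sumℚ k term ≡ scaledSum k /16^ k
  sumℚ≡scaledSum zero    = refl
  sumℚ≡scaledSum (suc k) = begin
    sumℚ k term ℚ.+ term (suc k)
      ≡⟨ cong₂ ℚ._+_ (sumℚ≡scaledSum k) (term≡central (suc k)) ⟩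
    scaledSum k ℚ./ q ℚ.+ central (suc k) ℚ./ (16 ℕ.* q)
      ≡⟨ /-+ (scaledSum k) (central (suc k)) q (16 ℕ.* q) ⟩
    _
      ≡⟨ /-cong-× (scaledSum k * + (16 ℕ.* q) + central (suc k) * + q) (scaledSum (suc k))
           (q ℕ.* (16 ℕ.* q)) (16 ℕ.* q) {{ℕ.m*n≢0 q (16 ℕ.* q)}} cross ⟩
    scaledSum (suc k) ℚ./ (16 ℕ.* q) ∎
    where
    q = 16 ℕ.^ k
    instance
      q≢0 : ℕ.NonZero q
      q≢0 = ℕ.m^n≢0 16 k
      16q≢0 : ℕ.NonZero (16 ℕ.* q)
      16q≢0 = ℕ.m^n≢0 16 (suc k)
    ident : ∀ f c q → (f * (+ 16 * q) + c * q) * (+ 16 * q) ≡ (+ 16 * f + c) * (q * (+ 16 * q))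
    ident = solve-∀
    cross : (scaledSum k * + (16 ℕ.* q) + central (suc k) * + q) * + (16 ℕ.* q) ≡ scaledSum (suc k) * + (q ℕ.* (16 ℕ.* q))
    cross = begin
      (scaledSum k * + (16 ℕ.* q) + central (suc k) * + q) * + (16 ℕ.* q)
        ≡⟨ cong (λ e → (scaledSum k * e + central (suc k) * + q) * e) (ℤ.pos-* 16 q) ⟩
      (scaledSum k * (+ 16 * + q) + central (suc k) * + q) * (+ 16 * + q)
        ≡⟨ ident (scaledSum k) (central (suc k)) (+ q) ⟩
      scaledSum (suc k) * (+ q * (+ 16 * + q))
        ≡⟨ cong (scaledSum (suc k) *_) (trans (cong (+ q *_) (sym (ℤ.pos-* 16 q))) (sym (ℤ.pos-* q (16 ℕ.* q)))) ⟩
      scaledSum (suc k) * + (q ℕ.* (16 ℕ.* q)) ∎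

  prime∣^⇒prime∣ : ∀ {p} → Prime p → ∀ x k → p ℕ∣.∣ x ℕ.^ k → p ℕ∣.∣ x
  prime∣^⇒prime∣ p-prime x zero    p∣1 with refl ← ℕ∣.∣1⇒≡1 p∣1 = contradiction p-prime ¬prime[1]
  prime∣^⇒prime∣ p-prime x (suc k) p∣  = [ (λ p∣x → p∣x) , prime∣^⇒prime∣ p-prime x k ]′ (euclidsLemma x (x ℕ.^ k) p-prime p∣)

  denominator∣ : ∀ i n .{{_ : ℕ.NonZero n}} → ↧ₙ (i ℚ./ n) ℕ∣.∣ n
  denominator∣ i n = ℕ∣.divides g (sym (trans (ℕ.*-comm g (↧ₙ (i ℚ./ n)))
    (ℤ.+-injective (trans (ℤ.pos-* (↧ₙ (i ℚ./ n)) g) (ℚ.↧-/ i n)))))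
    where
    g = gcd ℤ.∣ i ∣ n

  coprime-denominator : ∀ {p} → Prime p → 3 ℕ.< p → ∀ t k → Coprime (↧ₙ (t /16^ k)) p
  coprime-denominator {p} p-prime 3<p t k {d} (d∣den , d∣p) with prime⇒irreducible p-prime d∣p
  ... | inj₁ d≡1  = d≡1
  ... | inj₂ refl = contradiction
    -- `p` would divide a power of 16 = 2⁴, hence 2.
    (prime∣^⇒prime∣ p-prime 2 4 (prime∣^⇒prime∣ p-prime 16 k (ℕ∣.∣-trans d∣den (denominator∣ t (16 ℕ.^ k) {{ℕ.m^n≢0 16 k}}))))
    (λ p∣2 → ℕ.<⇒≱ 3<p (ℕ.≤-trans (ℕ∣.∣⇒≤ p∣2) (s≤s (s≤s z≤n))))

  -- Dividing the integer congruence by 16ᵏ turns its cofactor `t` into the witness t / 16ᵏ, whose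
  -- denominator is a power of 2.
  congruence-ℤ⇒ℚ : ∀ {p} → Prime p → 3 ℕ.< p → ∀ k ε →
    + p * + p ∣ scaledSum k - (+ 16) ^ k * ε → sumℚ k term ≡ ε ℚ./ 1 [modℚ p ℕ.^ 2 at p ]
  congruence-ℤ⇒ℚ {p} p-prime 3<p k ε (divides t F-16^ε≡tp²) = z , coprime-denominator p-prime 3<p t k , (begin
    sumℚ k term ℚ.- y          ≡⟨ cong (ℚ._- y) sum≡ ⟩
    (M ℚ.* z ℚ.+ y) ℚ.- y      ≡⟨ ℚ.+-assoc (M ℚ.* z) y (ℚ.- y) ⟩
    M ℚ.* z ℚ.+ (y ℚ.- y)      ≡⟨ cong (M ℚ.* z ℚ.+_) (ℚ.+-inverseʳ y) ⟩
    M ℚ.* z ℚ.+ ℚ.0ℚ           ≡⟨ ℚ.+-identityʳ (M ℚ.* z) ⟩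
    M ℚ.* z                    ∎)
    where
    q = 16 ℕ.^ k
    y = ε ℚ./ 1
    z = t /16^ k
    M = + (p ℕ.^ 2) ℚ./ 1
    F = scaledSum k
    instance
      q≢0 : ℕ.NonZero q
      q≢0 = ℕ.m^n≢0 16 k
      1q≢0 : ℕ.NonZero (1 ℕ.* q)
      1q≢0 = ℕ.m*n≢0 1 q
      1q1≢0 : ℕ.NonZero (1 ℕ.* q ℕ.* 1)
      1q1≢0 = ℕ.m*n≢0 (1 ℕ.* q) 1
    ident₁ : ∀ f e q → f * (1ℤ * q * 1ℤ) ≡ ((f - q * e) * 1ℤ + e * (1ℤ * q)) * q
    ident₁ = solve-∀
    ident₂ : ∀ t p e q → (t * (p * p) * 1ℤ + e * q) * q ≡ (p * (p * 1ℤ) * t * 1ℤ + e * q) * q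
    ident₂ = solve-∀
    cross : F * + (1 ℕ.* q ℕ.* 1) ≡ (+ (p ℕ.^ 2) * t * + 1 + ε * + (1 ℕ.* q)) * + q
    cross = begin
      F * + (1 ℕ.* q ℕ.* 1)
        ≡⟨ cong (F *_) (trans (ℤ.pos-* (1 ℕ.* q) 1) (cong (_* + 1) (ℤ.pos-* 1 q))) ⟩
      F * (1ℤ * + q * 1ℤ)
        ≡⟨ ident₁ F ε (+ q) ⟩
      ((F - + q * ε) * 1ℤ + ε * (1ℤ * + q)) * + q
        ≡⟨ cong₂ (λ e r → (e * 1ℤ + ε * r) * + q) (trans (cong (λ e → F - e * ε) (pos-^ 16 k)) F-16^ε≡tp²) (sym (ℤ.pos-* 1 q)) ⟩
      (t * (+ p * + p) * 1ℤ + ε * + (1 ℕ.* q)) * + q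
        ≡⟨ cong (λ e → (e * + 1 + ε * + (1 ℕ.* q)) * + q) (trans (ident₃ t (+ p)) (cong (_* t) (sym +p²))) ⟩
      (+ (p ℕ.^ 2) * t * + 1 + ε * + (1 ℕ.* q)) * + q ∎
      where
      ident₃ : ∀ t p → t * (p * p) ≡ p * (p * 1ℤ) * t
      ident₃ = solve-∀
      +p² : + (p ℕ.^ 2) ≡ + p * (+ p * 1ℤ)
      +p² = trans (ℤ.pos-* p (p ℕ.* 1)) (cong (+ p *_) (ℤ.pos-* p 1))
    sum≡ : sumℚ k term ≡ M ℚ.* z ℚ.+ y
    sum≡ = begin
      sumℚ k term     ≡⟨ sumℚ≡scaledSum k ⟩
      F ℚ./ q         ≡⟨ /-cong-× F (+ (p ℕ.^ 2) * t * + 1 + ε * + (1 ℕ.* q)) q (1 ℕ.* q ℕ.* 1) cross ⟩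
      _               ≡⟨ /-+ (+ (p ℕ.^ 2) * t) ε (1 ℕ.* q) 1 ⟨
      (+ (p ℕ.^ 2) * t) ℚ./ (1 ℕ.* q) ℚ.+ y ≡⟨ cong (ℚ._+ y) (/-* (+ (p ℕ.^ 2)) t 1 q) ⟨
      M ℚ.* z ℚ.+ y   ∎

  -- Binomial theorem and finite differences

  ∑-shift : ∀ n f → ∑ (suc n) f ≡ f 0 + ∑ n (f ∘ suc)
  ∑-shift zero    f = refl
  ∑-shift (suc n) f = trans (cong (_+ f (suc (suc n))) (∑-shift n f)) (ℤ.+-assoc (f 0) _ _)

  binomialTerm : ℕ → ℤ → ℕ → ℤ
  binomialTerm n x k = binom n k * x ^ k

  ∑-binomialTerm-suc : ∀ l n x →
    ∑ l (binomialTerm (suc n) x ∘ suc) ≡ x * ∑ l (binomialTerm n x) + ∑ l (binomialTerm n x ∘ suc)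
  ∑-binomialTerm-suc zero n x = ident x (binom n 1)
    where
    ident : ∀ x b → (1ℤ + b) * (x * 1ℤ) ≡ x * (1ℤ * 1ℤ) + b * (x * 1ℤ)
    ident = solve-∀
  ∑-binomialTerm-suc (suc l) n x = trans (cong (_+ binomialTerm (suc n) x (suc (suc l))) (∑-binomialTerm-suc l n x))
    (ident x (x ^ suc l) (binom n (suc l)) (binom n (suc (suc l))) (∑ l (binomialTerm n x))
      (∑ l (binomialTerm n x ∘ suc)))
    where
    ident : ∀ x y b c s t → x * s + t + (b + c) * (x * y) ≡ x * (s + b * y) + (t + c * (x * y))
    ident = solve-∀

  binomial-theorem : ∀ n x → (1ℤ + x) ^ n ≡ ∑ n (binomialTerm n x)
  binomial-theorem zero    x = refl
  binomial-theorem (suc n) x = begin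
    (1ℤ + x) * (1ℤ + x) ^ n
      ≡⟨ cong ((1ℤ + x) *_) (binomial-theorem n x) ⟩
    (1ℤ + x) * ∑ n (binomialTerm n x)
      ≡⟨ ident₁ x (∑ n (binomialTerm n x)) ⟩
    x * ∑ n (binomialTerm n x) + (∑ n (binomialTerm n x) + 0ℤ * x ^ suc n)
      ≡⟨ cong (λ b → x * ∑ n (binomialTerm n x) + (∑ n (binomialTerm n x) + b * x ^ suc n)) (binom-zero (ℕ.n<1+n n)) ⟨
    x * ∑ n (binomialTerm n x) + ∑ (suc n) (binomialTerm n x)
      ≡⟨ cong (_+_ (x * ∑ n (binomialTerm n x))) (∑-shift n (binomialTerm n x)) ⟩
    x * ∑ n (binomialTerm n x) + (1ℤ + ∑ n (binomialTerm n x ∘ suc))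
      ≡⟨ ident₂ (x * ∑ n (binomialTerm n x)) (∑ n (binomialTerm n x ∘ suc)) ⟩
    1ℤ + (x * ∑ n (binomialTerm n x) + ∑ n (binomialTerm n x ∘ suc))
      ≡⟨ cong (_+_ 1ℤ) (∑-binomialTerm-suc n n x) ⟨
    1ℤ + ∑ n (binomialTerm (suc n) x ∘ suc)
      ≡⟨ ∑-shift n (binomialTerm (suc n) x) ⟨
    ∑ (suc n) (binomialTerm (suc n) x) ∎
    where
    ident₁ : ∀ x s → (1ℤ + x) * s ≡ x * s + (s + 0ℤ)
    ident₁ = solve-∀
    ident₂ : ∀ a b → a + (1ℤ + b) ≡ 1ℤ + (a + b)
    ident₂ = solve-∀

  ∑-∣ : ∀ {d} n f → (∀ k → k ℕ.≤ n → d ∣ f k) → d ∣ ∑ n f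
  ∑-∣ zero    f d∣f = d∣f 0 z≤n
  ∑-∣ (suc n) f d∣f = ∣m∣n⇒∣m+n (∑-∣ n f (λ k k≤n → d∣f k (ℕ.m≤n⇒m≤1+n k≤n))) (d∣f (suc n) ℕ.≤-refl)

  difference : ℕ → (ℕ → ℤ) → ℕ → ℤ
  difference zero    f x = f x
  difference (suc n) f x = difference n f (suc x) - difference n f x

  -- Leibniz rule; only two terms occur because the second difference of y ↦ y is zero.
  difference-id* : ∀ n f x → difference (suc n) (λ y → + y * f y) x ≡
    (+ x + + suc n) * difference (suc n) f x + + suc n * difference n f x
  difference-id* zero    f x = ident (+ x) (f x) (f (suc x))
    where
    ident : ∀ x a b → (1ℤ + x) * b - x * a ≡ (x + 1ℤ) * (b - a) + 1ℤ * a
    ident = solve-∀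
  difference-id* (suc n) f x = trans (cong₂ _-_ (difference-id* n f (suc x)) (difference-id* n f x))
    (ident (+ x) (+ suc n) (difference n f (suc (suc x))) (difference n f (suc x)) (difference n f x))
    where
    ident : ∀ x n c b a → ((1ℤ + x + n) * (c - b) + n * b) - ((x + n) * (b - a) + n * a) ≡
      (x + (1ℤ + n)) * ((c - b) - (b - a)) + (1ℤ + n) * (b - a)
    ident = solve-∀

  -- In the Leibniz rule for y · yᵈ the leading term drops out, because the d-th difference of yᵈ is
  -- already constant.
  difference-power : ∀ d x → difference d (λ y → (+ y) ^ d) x ≡ + (d !)
  difference-power zero    x = refl
  difference-power (suc d) x = begin
    difference (suc d) (λ y → + y * (+ y) ^ d) x
      ≡⟨ difference-id* d (λ y → (+ y) ^ d) x ⟩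
    (+ x + + suc d) * (difference d (λ y → (+ y) ^ d) (suc x) - difference d (λ y → (+ y) ^ d) x)
      + + suc d * difference d (λ y → (+ y) ^ d) x
      ≡⟨ cong₂ (λ b a → (+ x + + suc d) * (b - a) + + suc d * a) (difference-power d (suc x)) (difference-power d x) ⟩
    (+ x + + suc d) * (+ (d !) - + (d !)) + + suc d * + (d !)
      ≡⟨ ident (+ x + + suc d) (+ suc d) (+ (d !)) ⟩
    + suc d * + (d !)
      ≡⟨ ℤ.pos-* (suc d) (d !) ⟨
    + (suc d !) ∎
    where
    ident : ∀ c n f → c * (f - f) + n * f ≡ n * f
    ident = solve-∀

  difference-∣ : ∀ {m c} n f x → (∀ y → y ℕ.≤ suc n → m ∣ f (y ℕ.+ x) - c) → m ∣ difference (suc n) f x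
  difference-∣ {m} {c} zero f x m∣f-c = subst (m ∣_) (ident (f (suc x)) (f x) c) (∣m∣n⇒∣m-n (m∣f-c 1 ℕ.≤-refl) (m∣f-c 0 z≤n))
    where
    ident : ∀ a b c → (a - c) - (b - c) ≡ a - b
    ident = solve-∀
  difference-∣ {m} {c} (suc n) f x m∣f-c = ∣m∣n⇒∣m-n
    (difference-∣ n f (suc x) (λ y y≤1+n → subst (λ l → m ∣ f l - c) (sym (ℕ.+-suc y x)) (m∣f-c (suc y) (s≤s y≤1+n))))
    (difference-∣ n f x (λ y y≤1+n → m∣f-c y (ℕ.m≤n⇒m≤1+n y≤1+n)))

  square-^ : ∀ x n → (x * x) ^ n ≡ x ^ (n ℕ.* 2)
  square-^ x zero    = refl
  square-^ x (suc n) = trans (cong (x * x *_) (square-^ x n)) (ℤ.*-assoc x x _)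

  neg-square-^ : ∀ x n → (- (x * x)) ^ n ≡ sgn n * x ^ (n ℕ.* 2)
  neg-square-^ x zero    = refl
  neg-square-^ x (suc n) = trans (cong (- (x * x) *_) (neg-square-^ x n)) (ident x (sgn n) (x ^ (n ℕ.* 2)))
    where
    ident : ∀ x s y → - (x * x) * (s * y) ≡ - s * (x * (x * y))
    ident = solve-∀

  *4≡+*2 : ∀ d → suc d ℕ.* 4 ≡ suc (suc d ℕ.+ d) ℕ.* 2
  *4≡+*2 d = begin
    suc d ℕ.* 4                        ≡⟨ ℕ.*-distribˡ-+ (suc d) 2 2 ⟩
    suc d ℕ.* 2 ℕ.+ suc d ℕ.* 2        ≡⟨ ℕ.*-distribʳ-+ 2 (suc d) (suc d) ⟨
    (suc d ℕ.+ suc d) ℕ.* 2            ≡⟨ cong (ℕ._* 2) (ℕ.+-suc (suc d) d) ⟩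
    suc (suc d ℕ.+ d) ℕ.* 2            ∎

  -- Fermat's theorem and the quadratic character of 3 modulo p

  module Residues {e : ℕ} (p-prime : Prime (suc (suc e))) where

    p : ℕ
    p = suc (suc e)

    open Mod p-prime

    P∤pos : ∀ {c} .{{_ : ℕ.NonZero c}} → c ℕ.< p → ¬ P ∣ + c
    P∤pos c<p P∣c = ℕ.<⇒≱ c<p (ℕ∣.∣⇒≤ (∣⇒∣ᵤ P∣c))

    P∤factorial : ∀ d → d ℕ.< p → ¬ P ∣ + (d !)
    P∤factorial zero    1<p P∣1  = contradiction (subst Prime (ℕ∣.∣1⇒≡1 (∣⇒∣ᵤ P∣1)) p-prime) ¬prime[1]
    P∤factorial (suc d) d<p P∣d! = [ P∤pos d<p , P∤factorial d (ℕ.<⇒≤ d<p) ]′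
      (P-euclid (+ suc d) (+ (d !)) (subst (P ∣_) (ℤ.pos-* (suc d) (d !)) P∣d!))

    frobenius : ∀ x → P ∣ (1ℤ + x) ^ p - (1ℤ + x ^ p)
    frobenius x = subst (P ∣_) (sym (begin
        (1ℤ + x) ^ p - (1ℤ + x ^ p)
          ≡⟨ cong (_- (1ℤ + x ^ p)) (trans (binomial-theorem p x) (∑-shift (suc e) (binomialTerm p x))) ⟩
        1ℤ + (S + binom p p * x ^ p) - (1ℤ + x ^ p)
          ≡⟨ cong (λ b → 1ℤ + (S + b * x ^ p) - (1ℤ + x ^ p)) (binom-sym p 0 (sym (ℕ.+-identityʳ p))) ⟩
        1ℤ + (S + 1ℤ * x ^ p) - (1ℤ + x ^ p)
          ≡⟨ ident S (x ^ p) ⟩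
        S ∎))
        (∑-∣ e (binomialTerm p x ∘ suc) λ k k≤e → ∣m⇒∣m*n (x ^ suc k) (P∣binom (suc k) refl (s≤s z≤n) (s≤s (s≤s k≤e))))
      where
      -- The prime itself is the prime power with exponent 1, so `P∣binom` disposes of the inner
      -- coefficients.
      open PrimePower 1 {p} (sym (ℕ.*-identityʳ p))
      S = ∑ e (binomialTerm p x ∘ suc)
      ident : ∀ s y → 1ℤ + (s + 1ℤ * y) - (1ℤ + y) ≡ s
      ident = solve-∀

    ^-cong : ∀ {x y} n → P ∣ x - y → P ∣ x ^ n - y ^ n
    ^-cong {x} {y} zero    P∣x-y = divides 0ℤ refl
    ^-cong {x} {y} (suc n) P∣x-y = subst (P ∣_) (ident x y (x ^ n) (y ^ n))
      (∣m∣n⇒∣m+n (∣n⇒∣m*n x (^-cong n P∣x-y)) (∣n⇒∣m*n (y ^ n) P∣x-y))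
      where
      ident : ∀ x y u v → x * (u - v) + v * (x - y) ≡ x * u - y * v
      ident = solve-∀

    fermat′ : ∀ x → P ∣ (+ x) ^ p - + x
    fermat′ zero    = divides 0ℤ refl
    fermat′ (suc x) = subst (P ∣_) (ident (+ suc x) ((+ suc x) ^ p) ((+ x) ^ p) (+ x)) (∣m∣n⇒∣m+n (frobenius (+ x)) (fermat′ x))
      where
      ident : ∀ s a b x → (a - (1ℤ + b)) + (b - x) ≡ a - (1ℤ + x)
      ident = solve-∀

    fermat : ∀ x → ¬ P ∣ + x → P ∣ (+ x) ^ suc e - 1ℤ
    fermat x P∤x = P-cancel (+ x) P∤x (subst (P ∣_) (ident (+ x) ((+ x) ^ suc e)) (fermat′ x))
      where
      ident : ∀ x y → x * y - x ≡ x * (y - 1ℤ)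
      ident = solve-∀

    opaque
      -- Finite differences replace the count of roots of a polynomial: if y^(d+1) were 1 at the d +
      -- 2 points 1, ..., d + 2, its (d + 1)-st difference (d + 1)! would be divisible by `p`,
      -- although d + 1 < p.
      nontrivial-power : ∀ d → suc (suc d) ℕ.< p → ∃[ x ] ¬ (P ∣ + x) × ¬ (P ∣ (+ x) ^ suc d - 1ℤ)
      nontrivial-power d 2+d<p with ℕ.anyUpTo? (λ y → ¬? (P ∣? (+ suc y) ^ suc d - 1ℤ)) (suc (suc d))
      ... | yes (y , y<2+d , P∤) = suc y , P∤pos (ℕ.≤-<-trans y<2+d 2+d<p) , P∤
      ... | no  all = ⊥-elim (P∤factorial (suc d) (ℕ.<⇒≤ 2+d<p) (subst (P ∣_) (difference-power (suc d) 1)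
          (difference-∣ {c = 1ℤ} d (λ y → (+ y) ^ suc d) 1 (λ y y≤1+d → decidable-stable (P ∣? _)
            (λ P∤ → all (y , s≤s y≤1+d , subst (λ l → ¬ (P ∣ (+ l) ^ suc d - 1ℤ)) (ℕ.+-comm y 1) P∤))))))

    mod-≡ : ∀ m n → P ∣ + m - + n → m ℕ.% p ≡ n ℕ.% p
    mod-≡ m n P∣m-n =
      [ (λ m≤n → sym (mod-≡-≤ m≤n (subst (P ∣_) (ident (+ m) (+ n)) (∣m⇒∣-m P∣m-n))))
      , (λ n≤m → mod-≡-≤ n≤m P∣m-n) ]′ (ℕ.≤-total m n)
      where
      ident : ∀ a b → - (a - b) ≡ b - a
      ident = solve-∀
      mod-≡-≤ : ∀ {m n} → n ℕ.≤ m → P ∣ + m - + n → m ℕ.% p ≡ n ℕ.% p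
      mod-≡-≤ {m} {n} n≤m P∣m-n = trans (cong (ℕ._% p) (sym (ℕ.m+[n∸m]≡n n≤m)))
        (ℕ.%-remove-+ʳ n (∣⇒∣ᵤ (subst (P ∣_) (trans (ℤ.m-n≡m⊖n m n) (ℤ.⊖-≥ n≤m)) P∣m-n)))

    ≡-mod : ∀ m n → m ℕ.% p ≡ n ℕ.% p → P ∣ + m - + n
    ≡-mod m n m%p≡n%p = divides (+ (m ℕ./ p) - + (n ℕ./ p)) (begin
      + m - + n
        ≡⟨ cong₂ _-_ (division m) (division n) ⟩
      (+ (m ℕ.% p) + + (m ℕ./ p) * P) - (+ (n ℕ.% p) + + (n ℕ./ p) * P)
        ≡⟨ cong (λ r → (+ r + + (m ℕ./ p) * P) - (+ (n ℕ.% p) + + (n ℕ./ p) * P)) m%p≡n%p ⟩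
      (+ (n ℕ.% p) + + (m ℕ./ p) * P) - (+ (n ℕ.% p) + + (n ℕ./ p) * P)
        ≡⟨ ident (+ (n ℕ.% p)) (+ (m ℕ./ p)) (+ (n ℕ./ p)) P ⟩
      (+ (m ℕ./ p) - + (n ℕ./ p)) * P ∎)
      where
      division : ∀ m → + m ≡ + (m ℕ.% p) + + (m ℕ./ p) * P
      division m = trans (cong +_ (ℕ.m≡m%n+[m/n]*n m p)) (cong (_+_ (+ (m ℕ.% p))) (ℤ.pos-* (m ℕ./ p) p))
      ident : ∀ r a b q → (r + a * q) - (r + b * q) ≡ (a - b) * q
      ident = solve-∀

    exponent-small : ∀ d k → suc e ≡ suc d ℕ.* suc (suc k) → suc (suc d) ℕ.< p
    exponent-small d k eq = s≤s (subst (suc d ℕ.<_) (sym eq) (ℕ.m<m*n (suc d) (suc (suc k)) (s≤s (s≤s z≤n))))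

    opaque
      -- A nontrivial cube root of unity w gives (2w + 1)² = -3.
      root-of-minus-3 : ∀ d → suc e ≡ suc d ℕ.* 3 → ∃[ z ] P ∣ + z * + z + + 3
      root-of-minus-3 d p-1≡ with x , P∤x , P∤x^d-1 ← nontrivial-power d (exponent-small d 1 p-1≡) =
        suc (2 ℕ.* w) , subst (P ∣_) (trans (ident₂ (+ w)) (cong (λ z → (1ℤ + z) * (1ℤ + z) + + 3) (sym (ℤ.pos-* 2 w))))
          (∣n⇒∣m*n (+ 4) (P-cancel (+ w - 1ℤ) (subst (λ y → ¬ (P ∣ y - 1ℤ)) (sym +w) P∤x^d-1)
            (subst (P ∣_) (begin
              (+ x) ^ suc e - 1ℤ                    ≡⟨ cong (λ l → (+ x) ^ l - 1ℤ) p-1≡ ⟩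
              (+ x) ^ (suc d ℕ.* 3) - 1ℤ            ≡⟨ cong (_- 1ℤ) (ℤ.^-*-assoc (+ x) (suc d) 3) ⟨
              ((+ x) ^ suc d) ^ 3 - 1ℤ              ≡⟨ cong (λ y → y ^ 3 - 1ℤ) +w ⟨
              (+ w) ^ 3 - 1ℤ                        ≡⟨ ident₁ (+ w) ⟩
              (+ w - 1ℤ) * (+ w * + w + + w + 1ℤ)   ∎) (fermat x P∤x))))
        where
        w : ℕ
        w = x ℕ.^ suc d
        +w : + w ≡ (+ x) ^ suc d
        +w = pos-^ x (suc d)
        ident₁ : ∀ w → w * (w * (w * 1ℤ)) - 1ℤ ≡ (w - 1ℤ) * (w * w + w + 1ℤ)
        ident₁ = solve-∀
        ident₂ : ∀ w → + 4 * (w * w + w + 1ℤ) ≡ (1ℤ + + 2 * w) * (1ℤ + + 2 * w) + + 3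
        ident₂ = solve-∀

      -- Here y = x^((p-1)/4) with x^((p-1)/2) not 1, so y⁴ - 1 = (y² - 1)(y² + 1) leaves only the
      -- second factor.
      root-of-minus-1 : ∀ d → suc e ≡ suc d ℕ.* 4 → ∃[ y ] P ∣ + y * + y + 1ℤ
      root-of-minus-1 d p-1≡ with x , P∤x , P∤x^2d-1
        ← nontrivial-power (suc d ℕ.+ d) (exponent-small (suc d ℕ.+ d) 0 (trans p-1≡ (*4≡+*2 d))) =
        y , P-cancel (+ y * + y - 1ℤ) (subst (λ z → ¬ (P ∣ z - 1ℤ)) (sym +y²) P∤x^2d-1)
          (subst (P ∣_) (begin
              (+ x) ^ suc e - 1ℤ                      ≡⟨ cong (λ l → (+ x) ^ l - 1ℤ) p-1≡ ⟩
              (+ x) ^ (suc d ℕ.* 4) - 1ℤ              ≡⟨ cong (_- 1ℤ) (ℤ.^-*-assoc (+ x) (suc d) 4) ⟨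
              ((+ x) ^ suc d) ^ 4 - 1ℤ                ≡⟨ cong (λ z → z ^ 4 - 1ℤ) (pos-^ x (suc d)) ⟨
              (+ y) ^ 4 - 1ℤ                          ≡⟨ ident₁ (+ y) ⟩
              (+ y * + y - 1ℤ) * (+ y * + y + 1ℤ)     ∎) (fermat x P∤x))
        where
        y : ℕ
        y = x ℕ.^ suc d
        +y² : + y * + y ≡ (+ x) ^ suc (suc d ℕ.+ d)
        +y² = begin
          + y * + y                          ≡⟨ cong₂ _*_ (pos-^ x (suc d)) (pos-^ x (suc d)) ⟩
          (+ x) ^ suc d * (+ x) ^ suc d      ≡⟨ ℤ.^-distribˡ-+-* (+ x) (suc d) (suc d) ⟨
          (+ x) ^ (suc d ℕ.+ suc d)          ≡⟨ cong ((+ x) ^_) (ℕ.+-suc (suc d) d) ⟩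
          (+ x) ^ suc (suc d ℕ.+ d)          ∎
        ident₁ : ∀ y → y * (y * (y * (y * 1ℤ))) - 1ℤ ≡ (y * y - 1ℤ) * (y * y + 1ℤ)
        ident₁ = solve-∀

    opaque
      -- For p ≡ 1 mod 12 both -1 and -3 are squares, and 3 is their product.
      3-is-square : ∀ l → suc e ≡ suc l ℕ.* 2 ℕ.* 6 → ∃[ x ] P ∣ + x * + x - + 3
      3-is-square l p-1≡
        with z , P∣z²+3 ← root-of-minus-3 (suc (suc (suc (l ℕ.* 4))))
               (trans p-1≡ (trans (ℕ.*-assoc (suc l) 2 6) (sym (ℕ.*-assoc (suc l) 4 3))))
           | y , P∣y²+1 ← root-of-minus-1 (suc (suc (l ℕ.* 3)))
               (trans p-1≡ (trans (ℕ.*-assoc (suc l) 2 6) (sym (ℕ.*-assoc (suc l) 3 4))))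
        = y ℕ.* z , subst (P ∣_) (trans (ident (+ y) (+ z)) (cong (λ x → x * x - + 3) (sym (ℤ.pos-* y z))))
            (∣m∣n⇒∣m-n (∣n⇒∣m*n (+ y * + y) P∣z²+3) (∣n⇒∣m*n (+ 3) P∣y²+1))
        where
        ident : ∀ y z → y * y * (z * z + + 3) - + 3 * (y * y + 1ℤ) ≡ y * z * (y * z) - + 3
        ident = solve-∀

    -- If x² = 3 and z² = -3 then z^(p-1) = (-1)^((p-1)/2) x^(p-1).
    power-quotient : ∀ n {k} x z → n ℕ.* 2 ≡ k → sgn n ≡ -1ℤ →
      P ∣ + x * + x - + 3 → P ∣ + z * + z + + 3 → P ∣ (+ z) ^ k - - ((+ x) ^ k)
    power-quotient n x z refl sgn-n P∣x²-3 P∣z²+3 = subst (P ∣_) (begin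
        (+ z * + z) ^ n - (- (+ x * + x)) ^ n
          ≡⟨ cong₂ _-_ (square-^ (+ z) n) (neg-square-^ (+ x) n) ⟩
        (+ z) ^ (n ℕ.* 2) - sgn n * (+ x) ^ (n ℕ.* 2)
          ≡⟨ cong (λ s → (+ z) ^ (n ℕ.* 2) - s * (+ x) ^ (n ℕ.* 2)) sgn-n ⟩
        (+ z) ^ (n ℕ.* 2) - -1ℤ * (+ x) ^ (n ℕ.* 2)
          ≡⟨ cong (_-_ ((+ z) ^ (n ℕ.* 2))) (ℤ.-1*i≡-i ((+ x) ^ (n ℕ.* 2))) ⟩
        (+ z) ^ (n ℕ.* 2) - - ((+ x) ^ (n ℕ.* 2)) ∎)
        (^-cong n (subst (P ∣_) (ident (+ x) (+ z)) (∣m∣n⇒∣m+n P∣z²+3 P∣x²-3)))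
      where
      ident : ∀ x z → (z * z + + 3) + (x * x - + 3) ≡ z * z - - (x * x)
      ident = solve-∀

    -- Now (p - 1)/2 is odd. A root x of 3 beside a root z of -3 would give z^(p-1) ≡ -x^(p-1),
    -- while Fermat makes both powers 1, so `p` would divide 2.
    3-is-not-square : ∀ l → suc e ≡ suc (l ℕ.* 2) ℕ.* 6 → 3 ℕ.< p → ∀ x → ¬ (P ∣ + x * + x - + 3)
    3-is-not-square l p-1≡ 3<p x P∣x²-3
      with z , P∣z²+3 ← root-of-minus-3 (suc (l ℕ.* 2 ℕ.* 2)) (trans p-1≡ (sym (ℕ.*-assoc (suc (l ℕ.* 2)) 2 3)))
      = P∤pos (ℕ.<⇒≤ 3<p) (subst (P ∣_) (ident₃ ((+ z) ^ suc e) ((+ x) ^ suc e))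
          (∣m∣n⇒∣m-n (∣m∣n⇒∣m-n z^≡-x^ (fermat z P∤z)) (fermat x P∤x)))
      where
      P∤3 : ¬ P ∣ + 3
      P∤3 = P∤pos 3<p
      P∤x : ¬ P ∣ + x
      P∤x P∣x = P∤3 (subst (P ∣_) (ident (+ x)) (∣m∣n⇒∣m-n (∣m⇒∣m*n (+ x) P∣x) P∣x²-3))
        where
        ident : ∀ x → x * x - (x * x - + 3) ≡ + 3
        ident = solve-∀
      P∤z : ¬ P ∣ + z
      P∤z P∣z = P∤3 (subst (P ∣_) (ident (+ z)) (∣m∣n⇒∣m-n P∣z²+3 (∣m⇒∣m*n (+ z) P∣z)))
        where
        ident : ∀ x → (x * x + + 3) - x * x ≡ + 3
        ident = solve-∀
      z^≡-x^ : P ∣ (+ z) ^ suc e - - ((+ x) ^ suc e)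
      z^≡-x^ = power-quotient (suc (l ℕ.* 2) ℕ.* 3) x z (trans (ℕ.*-assoc (suc (l ℕ.* 2)) 3 2) (sym p-1≡))
        (trans (sgn-*3 (suc (l ℕ.* 2))) (cong -_ (sgn-even l))) P∣x²-3 P∣z²+3
      ident₃ : ∀ u v → (u - - v) - (u - 1ℤ) - (v - 1ℤ) ≡ + 2
      ident₃ = solve-∀

  -- Evaluation of the Legendre and Jacobi symbols

  -- jacobi, smallestDivisor and isSquareModᵇ recurse through helpers local to Defs.  In each
  -- mutual block below the helper is named by unification with one unfolding of its caller.
  mutual
    jacobiLoop : ℕ → ℕ → ℕ → ℕ → ℤ
    jacobiLoop = _

    jacobi-unfold : ∀ a k → jacobi a (suc k) ≡
      (if suc k ≤ᵇ 1 then + 1 else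
        legendre a (smallestDivisor (suc k)) * jacobiLoop a (suc k) k (suc k ℕ./ suc (smallestDivisor (suc k) ℕ.∸ 1)))
    jacobi-unfold a k with suc k ℕ./ suc (smallestDivisor (suc k) ℕ.∸ 1)
    ... | w with smallestDivisor (suc k)
    ... | q with suc k
    ... | n = refl

  mutual
    smallestDivisorLoop : ℕ → ℕ → ℕ → ℕ
    smallestDivisorLoop = _

    smallestDivisor-unfold : ∀ k → smallestDivisor (suc k) ≡
      (if (suc k ℕ.% 2) ≡ᵇ 0 then 2 else smallestDivisorLoop (suc k) k 3)
    smallestDivisor-unfold k with suc k | 3
    ... | n | d = refl

  mutual
    isSquareLoop : ℕ → ℕ → ℕ → Bool
    isSquareLoop = _

    isSquareModᵇ-unfold : ∀ a r → isSquareModᵇ a (suc (suc r)) ≡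
      (if (suc r ℕ.* suc r) ℕ.% suc (suc r) ≡ᵇ a ℕ.% suc (suc r) then true
       else if (r ℕ.* r) ℕ.% suc (suc r) ≡ᵇ a ℕ.% suc (suc r) then true
       else isSquareLoop a (suc r) r)
    isSquareModᵇ-unfold a r with (suc r ℕ.* suc r) ℕ.% suc (suc r) ≡ᵇ a ℕ.% suc (suc r)
    ... | b with (r ℕ.* r) ℕ.% suc (suc r) ≡ᵇ a ℕ.% suc (suc r)
    ... | c with suc r
    ... | s = refl

  isSquareLoop-true : ∀ a q x → isSquareLoop a q x ≡ true → ∃[ y ] (y ℕ.* y) ℕ.% suc q ≡ a ℕ.% suc q
  isSquareLoop-true a q (suc x) eq with (x ℕ.* x) ℕ.% suc q ≡ᵇ a ℕ.% suc q in test
  ... | true  = x , ℕ.≡ᵇ⇒≡ _ _ (subst T (sym test) tt)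
  ... | false = isSquareLoop-true a q x eq

  isSquareLoop-false : ∀ a q x → isSquareLoop a q x ≡ false →
    ∀ y → y ℕ.< x → (y ℕ.* y) ℕ.% suc q ≢ a ℕ.% suc q
  isSquareLoop-false a q (suc x) eq y y<1+x sq with (x ℕ.* x) ℕ.% suc q ≡ᵇ a ℕ.% suc q in test
  ... | false = [ (λ y<x → isSquareLoop-false a q x eq y y<x sq)
                , (λ { refl → subst T test (ℕ.≡⇒≡ᵇ _ _ sq) }) ]′ (ℕ.m<1+n⇒m<n∨m≡n y<1+x)

  -- The loop tests only the remainders, so `y` is first reduced mod `suc q`.
  isSquareModᵇ-false : ∀ a q → isSquareModᵇ a (suc q) ≡ false → ∀ y → (y ℕ.* y) ℕ.% suc q ≢ a ℕ.% suc q
  isSquareModᵇ-false a q eq y sq = isSquareLoop-false a q (suc q) eq (y ℕ.% suc q) (ℕ.m%n<n y (suc q))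
    (trans (sym (ℕ.%-distribˡ-* y y (suc q))) sq)

  legendre-coprime : ∀ a q {b} → ¬ (suc q ℕ∣.∣ a) → isSquareModᵇ a (suc q) ≡ b →
    legendre a (suc q) ≡ (if b then + 1 else -[1+ 0 ])
  legendre-coprime a q q∤a square with a ℕ.% suc q ≡ᵇ 0 in test
  ... | true  = ⊥-elim (q∤a (ℕ∣.m%n≡0⇒n∣m a (suc q) (ℕ.≡ᵇ⇒≡ _ _ (subst T (sym test) tt))))
  ... | false = cong (λ b → if b then + 1 else -[1+ 0 ]) square

  even∨odd : ∀ r → (∃[ l ] r ≡ l ℕ.* 2) ⊎ (∃[ l ] r ≡ suc (l ℕ.* 2))
  even∨odd zero = inj₁ (0 , refl)
  even∨odd (suc r) with even∨odd r
  ... | inj₁ (l , refl) = inj₂ (l , refl)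
  ... | inj₂ (l , refl) = inj₁ (suc l , refl)

  module _ {e : ℕ} (p-prime : Prime (suc (suc e))) (3<p : 3 ℕ.< suc (suc e)) where
    open Residues p-prime

    legendre-3 : ∀ r → suc e ≡ r ℕ.* 6 → legendre 3 p ≡ sgn r
    legendre-3 r p-1≡ = go _ refl r p-1≡ (even∨odd r)
      where
      p∤3 : ¬ (p ℕ∣.∣ 3)
      p∤3 p∣3 = ℕ.<⇒≱ 3<p (ℕ∣.∣⇒≤ p∣3)
      go : ∀ b → isSquareModᵇ 3 p ≡ b → ∀ r → suc e ≡ r ℕ.* 6 →
           (∃[ l ] r ≡ l ℕ.* 2) ⊎ (∃[ l ] r ≡ suc (l ℕ.* 2)) → legendre 3 p ≡ sgn r
      go true  square _ _ (inj₁ (l , refl)) = trans (legendre-coprime 3 (suc e) p∤3 square) (sym (sgn-even l))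
      go false square _ _ (inj₂ (l , refl)) = trans (legendre-coprime 3 (suc e) p∤3 square) (cong -_ (sym (sgn-even l)))
      -- Only a positive `l` can occur: r = 0 would make p - 1 zero.
      go false square _ p-1≡ (inj₁ (suc l , refl)) with x , P∣x²-3 ← 3-is-square l p-1≡ =
        contradiction (mod-≡ (x ℕ.* x) 3 (subst (λ y → + p ∣ y - + 3) (sym (ℤ.pos-* x x)) P∣x²-3))
          (isSquareModᵇ-false 3 (suc e) square x)
      go true  square _ p-1≡ (inj₂ (l , refl)) with x , x²≡3 ← isSquareLoop-true 3 (suc e) p square =
        contradiction (subst (λ y → + p ∣ y - + 3) (ℤ.pos-* x x) (≡-mod (x ℕ.* x) 3 x²≡3)) (3-is-not-square l p-1≡ 3<p x)

  coprime-^ : ∀ {d p} k → Coprime d p → d ℕ∣.∣ p ℕ.^ k → d ≡ 1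
  coprime-^ zero    _       d∣1 = ℕ∣.∣1⇒≡1 d∣1
  coprime-^ (suc k) coprime d∣  = coprime-^ k coprime (coprime-divisor coprime d∣)

  -- A trial divisor strictly between 1 and `p` is coprime to `p`, hence divides its power only if
  -- it is 1. The bounds say that the search has not passed `p` and that the fuel suffices to reach
  -- it.
  smallestDivisorLoop-prime : ∀ {p} k → Prime p → ∀ fuel d → 1 ℕ.≤ d → suc d ℕ.≤ p → p ℕ.< suc d ℕ.+ fuel →
    smallestDivisorLoop (p ℕ.^ suc k) fuel (suc d) ≡ p
  smallestDivisorLoop-prime {p} k p-prime zero       d 1≤d d<p p≤d =
    contradiction d<p (ℕ.<⇒≱ (subst (p ℕ.<_) (ℕ.+-identityʳ (suc d)) p≤d))
  smallestDivisorLoop-prime {p} k p-prime (suc fuel) d 1≤d d<p p<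
    with p ℕ.^ suc k ℕ.% suc d ≡ᵇ 0 in test | ℕ.m≤n⇒m<n∨m≡n d<p
  ... | true  | inj₂ 1+d≡p = 1+d≡p
  ... | false | inj₁ 1+d<p = smallestDivisorLoop-prime k p-prime fuel (suc d) (s≤s z≤n) 1+d<p (subst (p ℕ.<_) (ℕ.+-suc (suc d) fuel) p<)
  ... | true  | inj₁ 1+d<p = contradiction
    (coprime-^ (suc k) (Coprime.sym (prime⇒coprime p-prime 1+d<p))
      (ℕ∣.m%n≡0⇒n∣m (p ℕ.^ suc k) (suc d) (ℕ.≡ᵇ⇒≡ _ _ (subst T (sym test) tt))))
    (λ { refl → ℕ.<⇒≱ 1≤d z≤n })
  ... | false | inj₂ refl = ⊥-elim (subst T test (ℕ.≡⇒≡ᵇ _ _ (ℕ∣.n∣m⇒m%n≡0 (p ℕ.^ suc k) p (ℕ∣.m∣m*n (p ℕ.^ k)))))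

  smallestDivisor-prime-power : ∀ {e} k → Prime (suc (suc e)) → smallestDivisor (suc (suc e) ℕ.^ suc k) ≡ suc (suc e)
  smallestDivisor-prime-power {e} k p-prime = smallestDivisorLoop-prime k p-prime (p ℕ.^ suc k) 1 (s≤s z≤n) (s≤s (s≤s z≤n))
      (s≤s (ℕ.m≤n⇒m≤1+n (ℕ.m≤m*n p (p ℕ.^ k) {{ℕ.m^n≢0 p k}})))
    where p = suc (suc e)

  jacobiLoop-prime-power : ∀ {e} a n b fuel → Prime (suc (suc e)) → b ℕ.≤ fuel →
    jacobiLoop a n fuel (suc (suc e) ℕ.^ b) ≡ legendre a (suc (suc e)) ^ b
  jacobiLoop-prime-power     a n zero    zero       p-prime b≤ = refl
  jacobiLoop-prime-power     a n zero    (suc fuel) p-prime b≤ = refl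
  jacobiLoop-prime-power {e} a n (suc b) (suc fuel) p-prime (s≤s b≤) with suc (suc e) ℕ.^ suc b ≤ᵇ 1 in test
  ... | true  = contradiction (ℕ.≤ᵇ⇒≤ _ _ (subst T (sym test) tt))
    (ℕ.<⇒≱ (ℕ.≤-trans (s≤s (s≤s z≤n)) (ℕ.m≤m*n (suc (suc e)) (suc (suc e) ℕ.^ b) {{ℕ.m^n≢0 (suc (suc e)) b}})))
  ... | false = begin
    legendre a (smallestDivisor (p ℕ.^ suc b))
      * jacobiLoop a n fuel (p ℕ.^ suc b ℕ./ suc (smallestDivisor (p ℕ.^ suc b) ℕ.∸ 1))
      ≡⟨ cong (λ q → legendre a q * jacobiLoop a n fuel (p ℕ.^ suc b ℕ./ suc (q ℕ.∸ 1)))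
           (smallestDivisor-prime-power b p-prime) ⟩
    legendre a p * jacobiLoop a n fuel (p ℕ.* p ℕ.^ b ℕ./ p)
      ≡⟨ cong (λ l → legendre a p * jacobiLoop a n fuel l) (trans (cong (ℕ._/ p) (ℕ.*-comm p (p ℕ.^ b))) (ℕ.m*n/n≡m (p ℕ.^ b) p)) ⟩
    legendre a p * jacobiLoop a n fuel (p ℕ.^ b)
      ≡⟨ cong (legendre a p *_) (jacobiLoop-prime-power a n b fuel p-prime b≤) ⟩
    legendre a p * legendre a p ^ b ∎
    where p = suc (suc e)

  -- Supplies the fuel: `jacobi` runs with fuel pᵇ and needs one unit for each of the b prime
  -- factors.
  n≤m^n : ∀ m n .{{_ : ℕ.NonTrivial m}} → n ℕ.≤ m ℕ.^ n
  n≤m^n m zero = z≤n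
  n≤m^n m@(suc (suc _)) (suc n) = ℕ.+-mono-≤ (ℕ.m^n>0 m n) (ℕ.≤-trans (n≤m^n m n) (ℕ.m≤m+n _ _))

  jacobi-prime-power : ∀ {e} a b → Prime (suc (suc e)) → jacobi a (suc (suc e) ℕ.^ b) ≡ legendre a (suc (suc e)) ^ b
  jacobi-prime-power {e} a b p-prime =
    jacobiLoop-prime-power a (suc (suc e) ℕ.^ b) b (suc (suc e) ℕ.^ b) p-prime (n≤m^n (suc (suc e)) b)

  -- Reduction of the exponent and of the summation bound

  -- (6r + 1)(6m + 1) = 6 (m + r (6m + 1)) + 1, and the new cofactor has the parity of m + r. Thus
  -- the a-th power of the Legendre symbol becomes (-1)ᵐ.
  power-1-mod-6 : ∀ r a → ∃[ m ] suc (m ℕ.* 2 ℕ.* 3) ≡ suc (r ℕ.* 6) ℕ.^ a × sgn r ^ a ≡ sgn m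
  power-1-mod-6 r zero    = 0 , refl , refl
  power-1-mod-6 r (suc a) with m , m≡ , sgn≡ ← power-1-mod-6 r a = m ℕ.+ r ℕ.* suc (m ℕ.* 6) ,
    (begin
      suc ((m ℕ.+ r ℕ.* suc (m ℕ.* 6)) ℕ.* 2 ℕ.* 3)           ≡⟨ cong suc (ℕ.*-assoc (m ℕ.+ r ℕ.* suc (m ℕ.* 6)) 2 3) ⟩
      suc ((m ℕ.+ r ℕ.* suc (m ℕ.* 6)) ℕ.* 6)                 ≡⟨ ident r m ⟩
      suc (r ℕ.* 6) ℕ.* suc (m ℕ.* 6)                         ≡⟨ cong (λ l → suc (r ℕ.* 6) ℕ.* suc l) (ℕ.*-assoc m 2 3) ⟨
      suc (r ℕ.* 6) ℕ.* suc (m ℕ.* 2 ℕ.* 3)                   ≡⟨ cong (suc (r ℕ.* 6) ℕ.*_) m≡ ⟩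
      suc (r ℕ.* 6) ℕ.* suc (r ℕ.* 6) ℕ.^ a                   ∎) ,
    (begin
      sgn r * sgn r ^ a                                       ≡⟨ cong (sgn r *_) sgn≡ ⟩
      sgn r * sgn m                                           ≡⟨ ident₂ (sgn r) (sgn m) ⟩
      sgn m * (sgn r * 1ℤ)                                    ≡⟨ cong (λ s → sgn m * (sgn r * s)) (sgn-even (r ℕ.* m ℕ.* 3)) ⟨
      sgn m * (sgn r * sgn (r ℕ.* m ℕ.* 3 ℕ.* 2))             ≡⟨ cong (sgn m *_) (sgn-+ r (r ℕ.* m ℕ.* 3 ℕ.* 2)) ⟨
      sgn m * sgn (r ℕ.+ r ℕ.* m ℕ.* 3 ℕ.* 2)                 ≡⟨ sgn-+ m _ ⟨
      sgn (m ℕ.+ (r ℕ.+ r ℕ.* m ℕ.* 3 ℕ.* 2))                 ≡⟨ cong (λ l → sgn (m ℕ.+ l)) (ident₃ r m) ⟩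
      sgn (m ℕ.+ r ℕ.* suc (m ℕ.* 6))                         ∎)
    where
    ident : ∀ r m → 1 ℕ.+ (m ℕ.+ r ℕ.* (1 ℕ.+ m ℕ.* 6)) ℕ.* 6 ≡ (1 ℕ.+ r ℕ.* 6) ℕ.* (1 ℕ.+ m ℕ.* 6)
    ident = ℕ-solve-∀
    ident₂ : ∀ a b → a * b ≡ b * (a * 1ℤ)
    ident₂ = solve-∀
    ident₃ : ∀ r m → r ℕ.+ r ℕ.* m ℕ.* 3 ℕ.* 2 ≡ r ℕ.* (1 ℕ.+ m ℕ.* 6)
    ident₃ = ℕ-solve-∀

  -- In p = 3q + 1 an odd q would make `p` even, and q = 0 would give p = 1. The form `suc r` also
  -- records p ≥ 7, so that 2 and 3 are units mod `p`.
  prime-1-mod-6 : ∀ {p} → Prime p → p ℕ.% 2 ≡ 1 → p ℕ.% 3 ≡ 1 → ∃[ r ] p ≡ suc (suc r ℕ.* 6)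
  prime-1-mod-6 {p} p-prime p%2 p%3
    with p ℕ./ 3 | even∨odd (p ℕ./ 3) | trans (ℕ.m≡m%n+[m/n]*n p 3) (cong (ℕ._+ p ℕ./ 3 ℕ.* 3) p%3)
  ... | _ | inj₁ (zero  , refl) | refl = contradiction p-prime ¬prime[1]
  ... | _ | inj₁ (suc r , refl) | refl = r , cong suc (ℕ.*-assoc (suc r) 2 3)
  ... | _ | inj₂ (l , refl)     | refl = contradiction
    (trans (sym p%2) (trans (cong (ℕ._% 2) (ident l)) (ℕ.m*n%n≡0 (2 ℕ.+ l ℕ.* 3) 2))) λ ()
    where
    ident : ∀ l → 1 ℕ.+ (1 ℕ.+ l ℕ.* 2) ℕ.* 3 ≡ (2 ℕ.+ l ℕ.* 3) ℕ.* 2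
    ident = ℕ-solve-∀

  -- 5 (6m + 1) = 6 · 5m + 5 leaves remainder 5.
  floor-5n/6 : ∀ m → (5 ℕ.* suc (m ℕ.* 2 ℕ.* 3)) ℕ./ 6 ≡ m ℕ.* 5
  floor-5n/6 m = begin
    (5 ℕ.* suc (m ℕ.* 2 ℕ.* 3)) ℕ./ 6     ≡⟨ cong (ℕ._/ 6) (ident m) ⟩
    (5 ℕ.+ m ℕ.* 5 ℕ.* 6) ℕ./ 6           ≡⟨ ℕ.+-distrib-/-∣ʳ 5 {m ℕ.* 5 ℕ.* 6} {6} (ℕ∣.divides (m ℕ.* 5) refl) ⟩
    (m ℕ.* 5 ℕ.* 6) ℕ./ 6                 ≡⟨ ℕ.m*n/n≡m (m ℕ.* 5) 6 ⟩
    m ℕ.* 5                               ∎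
    where
    ident : ∀ m → 5 ℕ.* (1 ℕ.+ m ℕ.* 2 ℕ.* 3) ≡ 5 ℕ.+ m ℕ.* 5 ℕ.* 6
    ident = ℕ-solve-∀

  central-sum : ∀ p a → Prime p → p ℕ.% 2 ≡ 1 → p ℕ.% 3 ≡ 1 →
    sumℚ ((5 ℕ.* p ℕ.^ a) ℕ./ 6) term ≡ (jacobi 3 (p ℕ.^ a) ℚ./ 1) [modℚ p ℕ.^ 2 at p ]
  central-sum p a p-prime p%2 p%3
    with r , refl ← prime-1-mod-6 p-prime p%2 p%3
    with m , n≡p^a , sgn^≡ ← power-1-mod-6 (suc r) a =
    subst₂ (λ k ε → sumℚ k term ≡ (ε ℚ./ 1) [modℚ p ℕ.^ 2 at p ])
      (trans (sym (floor-5n/6 m)) (cong (λ n → (5 ℕ.* n) ℕ./ 6) n≡p^a))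
      (sym (trans (jacobi-prime-power 3 a p-prime) (trans (cong (_^ a) (legendre-3 p-prime 3<p (suc r) refl)) sgn^≡)))
      (congruence-ℤ⇒ℚ p-prime 3<p (m ℕ.* 5) (sgn m) (Supercongruence.scaledSum-congruence p-prime 3<p a m n≡p^a))
    where
    3<p : 3 ℕ.< suc (suc r ℕ.* 6)
    3<p = s≤s (s≤s (s≤s (s≤s z≤n)))

open import Data.Nat using (ℕ; _^_; _*_; _/_; _%_; _<_)
open import Data.Nat.Primality using (Prime)
open import Data.Rational using (ℚ) renaming (_/_ to _/ℚ_)
open import Relation.Binary.PropositionalEquality using (_≡_)

theorem1p1 : (p a : ℕ) → Prime p → p % 2 ≡ 1 → p % 3 ≡ 1 → 0 < a →
    sumℚ ((5 * p ^ a) / 6) term ≡ (jacobi 3 (p ^ a) /ℚ 1) [modℚ p ^ 2 at p ]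
theorem1p1 p a p-prime p%2 p%3 _ = Proof.central-sum p a p-prime p%2 p%3
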